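{- (a) There exist matroids whose matroid polytope $P(f)$ (with the representation below) is GCW but not ICW, i.e. has a circuit walk that is not integral. (b) There exist transportation polytopes (with the representation below) that are ICW but not VCW. (c) There exist bounded-size partition polytopes $PP(\kappa^{\pm})$ (with the representation below) that are VCW but not ECW. (d) All fixed-size partition polytopes $PP(\kappa)$ (with the representation below) are ECW.
   Context: Circuits: for $P=\{x: Ax=b,\ Bx\le d\}$ with rational $A,B$, $\mathcal C(A,B)$ is the set of $g\in\ker(A)\setminus\{0\}$ with coprime integer components such that the support of $Bg$ is inclusion-minimal among supports of $Bx$, $x\in\ker(A)\setminus\{0\}$. For vertices $v^{(1)},v^{(2)}$ of $P$, a circuit walk is a sequence $v^{(1)}=y^{(0)},\dots,y^{(k)}=v^{(2)}$ with $y^{(i)}\in P$, $y^{(i+1)}=y^{(i)}+\alpha_i g^{(i)}$ for some $g^{(i)}\in\mathcal C(A,B)$, $\alpha_i>0$, and $y^{(i)}+\alpha g^{(i)}\notin P$ for all $\alpha>\alpha_i$. It is integral if all $y^{(i)}$ are integer, a vertex walk if all $y^{(i)}$ are vertices, an edge walk if it is a vertex walk and each $[y^{(i)},y^{(i+1)}]$ is an edge of $P$. An integral polyhedron (all vertices integer) is GCW; it is ICW if all its circuit walks are integral, VCW if all are vertex walks, ECW if all are edge walks. Matroid polytope: for a matroid with ground set $E$ and rank function $f$, $P(f)=\{x\in\mathbb R^E: x\ge 0,\ \sum_{e\in S}x_e\le f(S)\ \forall S\subseteq E\}$ (the convex hull of incidence vectors of independent sets), circuits taken w.r.t. this system. Transportation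 polytope: for $u\in\mathbb Z_+^m$, $v\in\mathbb Z_+^n$, the set of $y\in\mathbb R^{mn}$ with $\sum_{j=1}^n y_{ij}=u_i$ ($i=1..m$), $\sum_{i=1}^m y_{ij}=v_j$ ($j=1..n$), $y_{ij}\ge 0$. Bounded-size partition polytope: for $k$ clusters, $n$ items and $\kappa_i^-,\kappa_i^+\in\mathbb Z_+$, $PP(\kappa^\pm)$ is the set of $y\in\mathbb R^{kn}$ with $\sum_{i=1}^k y_{ij}=1$ ($j=1..n$), $\sum_{j=1}^n y_{ij}\ge\kappa_i^-$, $\sum_{j=1}^n y_{ij}\le\kappa_i^+$ ($i=1..k$), $y_{ij}\ge 0$. Fixed-size partition polytope: for $\kappa_i\in\mathbb Z_+$, $PP(\kappa)$ is the set of $y\in\mathbb R^{kn}$ with $\sum_{j=1}^n y_{ij}=\kappa_i$ ($i=1..k$), $\sum_{i=1}^k y_{ij}=1$ ($j=1..n$), $y_{ij}\ge 0$.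
   Formalization: The polytopes are taken in rational rather than real space: points, supporting functionals and step lengths are rational. Since all data are rational, vertices, circuits and maximal steps are rational anyway. -}

module Defs where

open import Data.Nat as ℕ using (ℕ; zero; suc)
open import Data.Nat.Divisibility using (_∣_)
open import Data.Integer as ℤ using (ℤ; +_)
open import Data.Rational using (ℚ; 0ℚ; 1ℚ; _+_; _*_; -_; _-_; _≤_; _<_; ↥_; ↧ₙ_; _/_)
open import Data.Fin using (Fin; zero; suc; inject₁; fromℕ; remQuot; _≟_)
open import Data.Fin.Subset using (Subset; _∪_; _∩_; _⊆_; ∣_∣)
open import Data.Bool using (Bool; true; false; if_then_else_)
open import Data.Vec using (lookup)
open import Data.Product using (Σ; ∃; _×_; _,_; proj₁; proj₂)
open import Data.Sum using (_⊎_; inj₁; inj₂)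
open import Data.Empty using (⊥)
open import Relation.Nullary using (¬_; does)
open import Relation.Binary.PropositionalEquality using (_≡_; _≢_)

Vec℘ : ℕ → Set
Vec℘ n = Fin n → ℚ

∑ : ∀ {n} → (Fin n → ℚ) → ℚ
∑ {zero}  f = 0ℚ
∑ {suc n} f = f zero + ∑ (λ j → f (suc j))

_·_ : ∀ {n} → Vec℘ n → Vec℘ n → ℚ
a · x = ∑ (λ j → a j * x j)

_≈_ : ∀ {n} → Vec℘ n → Vec℘ n → Set
x ≈ y = ∀ j → x j ≡ y j

_+ᵥ_ : ∀ {n} → Vec℘ n → Vec℘ n → Vec℘ n
(x +ᵥ y) j = x j + y j

_*ᵥ_ : ∀ {n} → ℚ → Vec℘ n → Vec℘ n
(a *ᵥ x) j = a * x j

ℕ→ℚ : ℕ → ℚ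
ℕ→ℚ k = (+ k) / 1

IsIntegerℚ : ℚ → Set
IsIntegerℚ q = ↧ₙ q ≡ 1

IntegerPoint : ∀ {n} → Vec℘ n → Set
IntegerPoint x = ∀ j → IsIntegerℚ (x j)

-- A polyhedron P = {x ∈ ℚ^n : A x = b, B x ≤ d}, given by its
-- representation; equality rows are indexed by a type I, inequality
-- rows by a type J (finite in all instances below).

record Polyhedron (n : ℕ) : Set₁ where
  field
    I : Set
    J : Set
    A : I → Vec℘ n
    b : I → ℚ
    B : J → Vec℘ n
    d : J → ℚ

module _ {n : ℕ} (P : Polyhedron n) where
  open Polyhedron P

  _∈P : Vec℘ n → Set
  x ∈P = (∀ i → A i · x ≡ b i) × (∀ j → B j · x ≤ d j)

  InKer : Vec℘ n → Set
  InKer x = ∀ i → A i · x ≡ 0ℚ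

  NonZero : Vec℘ n → Set
  NonZero x = ∃ λ j → x j ≢ 0ℚ

  SuppSub : Vec℘ n → Vec℘ n → Set
  SuppSub x y = ∀ j → B j · x ≢ 0ℚ → B j · y ≢ 0ℚ

  CoprimeInteger : Vec℘ n → Set
  CoprimeInteger g = IntegerPoint g ×
    (∀ (k : ℕ) → (∀ j → k ∣ ℤ.∣ ↥ (g j) ∣) → k ≡ 1)

  IsCircuit : Vec℘ n → Set
  IsCircuit g = InKer g × NonZero g × CoprimeInteger g ×
    (∀ x → InKer x → NonZero x → SuppSub x g → SuppSub g x)

  Valid : Vec℘ n → ℚ → Set
  Valid c δ = ∀ y → y ∈P → c · y ≤ δ

  IsVertex : Vec℘ n → Set
  IsVertex v = v ∈P × Σ (Vec℘ n) λ c → Σ ℚ λ δ →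
    Valid c δ × c · v ≡ δ × (∀ y → y ∈P → c · y ≡ δ → y ≈ v)

  IsEdge : Vec℘ n → Vec℘ n → Set
  IsEdge u w = IsVertex u × IsVertex w × ¬ (u ≈ w) ×
    Σ (Vec℘ n) λ c → Σ ℚ λ δ → Valid c δ × c · u ≡ δ × c · w ≡ δ ×
    (∀ y → y ∈P → c · y ≡ δ →
       ∃ λ λ' → 0ℚ ≤ λ' × λ' ≤ 1ℚ × y ≈ ((λ' *ᵥ u) +ᵥ ((1ℚ - λ') *ᵥ w)))

  CircuitStep : Vec℘ n → Vec℘ n → Set
  CircuitStep y y' = Σ (Vec℘ n) λ g → Σ ℚ λ α →
    IsCircuit g × 0ℚ < α × y' ≈ (y +ᵥ (α *ᵥ g)) ×
    (∀ α' → α < α' → ¬ ((y +ᵥ (α' *ᵥ g)) ∈P))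

  record CircuitWalk (v₁ v₂ : Vec℘ n) : Set where
    field
      k    : ℕ
      y    : Fin (suc k) → Vec℘ n
      start : y zero ≈ v₁
      end   : y (fromℕ k) ≈ v₂
      inP   : ∀ i → y i ∈P
      step  : ∀ (i : Fin k) → CircuitStep (y (inject₁ i)) (y (suc i))

  open CircuitWalk

  IntegralWalk : ∀ {v₁ v₂} → CircuitWalk v₁ v₂ → Set
  IntegralWalk W = ∀ i → IntegerPoint (y W i)

  VertexWalk : ∀ {v₁ v₂} → CircuitWalk v₁ v₂ → Set
  VertexWalk W = ∀ i → IsVertex (y W i)

  EdgeWalk : ∀ {v₁ v₂} → CircuitWalk v₁ v₂ → Set
  EdgeWalk W = VertexWalk W × (∀ (i : Fin (k W)) → IsEdge (y W (inject₁ i)) (y W (suc i)))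

  AllWalks : (∀ {v₁ v₂} → CircuitWalk v₁ v₂ → Set) → Set
  AllWalks Q = ∀ v₁ v₂ → IsVertex v₁ → IsVertex v₂ → (W : CircuitWalk v₁ v₂) → Q W

  GCW : Set
  GCW = ∀ v → IsVertex v → IntegerPoint v

  ICW : Set
  ICW = GCW × AllWalks IntegralWalk

  VCW : Set
  VCW = GCW × AllWalks VertexWalk

  ECW : Set
  ECW = GCW × AllWalks EdgeWalk

record Matroid (m : ℕ) : Set where
  field
    f          : Subset m → ℕ
    bounded    : ∀ S → f S ℕ.≤ ∣ S ∣
    monotone   : ∀ S T → S ⊆ T → f S ℕ.≤ f T
    submodular : ∀ S T → f (S ∪ T) ℕ.+ f (S ∩ T) ℕ.≤ f S ℕ.+ f T

unit : ∀ {n} → Fin n → Vec℘ n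
unit e j = if does (e ≟ j) then 1ℚ else 0ℚ

indicator : ∀ {n} → Subset n → Vec℘ n
indicator S j = if lookup S j then 1ℚ else 0ℚ

MatroidPolytope : ∀ {m} → Matroid m → Polyhedron m
MatroidPolytope {m} M = record
  { I = ⊥ ; J = Fin m ⊎ Subset m
  ; A = λ () ; b = λ ()
  ; B = λ { (inj₁ e) → (- 1ℚ) *ᵥ unit e ; (inj₂ S) → indicator S }
  ; d = λ { (inj₁ e) → 0ℚ ; (inj₂ S) → ℕ→ℚ (Matroid.f M S) } }

-- Matrix-shaped variables: y ∈ ℚ^{m×n} stored as Fin (m * n), with
-- y_{ij} at index combine i j (remQuot is its inverse).

rowSel : ∀ m n → Fin m → Vec℘ (m ℕ.* n)
rowSel m n i q = if does (proj₁ (remQuot {m} n q) ≟ i) then 1ℚ else 0ℚ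

colSel : ∀ m n → Fin n → Vec℘ (m ℕ.* n)
colSel m n j q = if does (proj₂ (remQuot {m} n q) ≟ j) then 1ℚ else 0ℚ

TransportationPolytope : ∀ m n → (Fin m → ℕ) → (Fin n → ℕ) → Polyhedron (m ℕ.* n)
TransportationPolytope m n u v = record
  { I = Fin m ⊎ Fin n ; J = Fin (m ℕ.* n)
  ; A = λ { (inj₁ i) → rowSel m n i ; (inj₂ j) → colSel m n j }
  ; b = λ { (inj₁ i) → ℕ→ℚ (u i) ; (inj₂ j) → ℕ→ℚ (v j) }
  ; B = λ q → (- 1ℚ) *ᵥ unit q
  ; d = λ q → 0ℚ }

-- bounded-size partition polytope PP(κ⁻,κ⁺), k clusters, n items:
-- ∑_i y_ij = 1, ∑_j y_ij ≥ κ⁻_i (written -∑_j y_ij ≤ -κ⁻_i),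
-- ∑_j y_ij ≤ κ⁺_i, y ≥ 0
BoundedPartitionPolytope : ∀ k n → (Fin k → ℕ) → (Fin k → ℕ) → Polyhedron (k ℕ.* n)
BoundedPartitionPolytope k n κ⁻ κ⁺ = record
  { I = Fin n ; J = Fin k ⊎ Fin k ⊎ Fin (k ℕ.* n)
  ; A = λ j → colSel k n j
  ; b = λ j → 1ℚ
  ; B = λ { (inj₁ i) → (- 1ℚ) *ᵥ rowSel k n i
          ; (inj₂ (inj₁ i)) → rowSel k n i
          ; (inj₂ (inj₂ q)) → (- 1ℚ) *ᵥ unit q }
  ; d = λ { (inj₁ i) → - ℕ→ℚ (κ⁻ i)
          ; (inj₂ (inj₁ i)) → ℕ→ℚ (κ⁺ i)
          ; (inj₂ (inj₂ q)) → 0ℚ } }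

FixedPartitionPolytope : ∀ k n → (Fin k → ℕ) → Polyhedron (k ℕ.* n)
FixedPartitionPolytope k n κ = record
  { I = Fin k ⊎ Fin n ; J = Fin (k ℕ.* n)
  ; A = λ { (inj₁ i) → rowSel k n i ; (inj₂ j) → colSel k n j }
  ; b = λ { (inj₁ i) → ℕ→ℚ (κ i) ; (inj₂ j) → 1ℚ }
  ; B = λ q → (- 1ℚ) *ᵥ unit q
  ; d = λ q → 0ℚ }

{-# OPTIONS --safe #-}
module Submission where

-- For transportation-like polytopes, let Z be {0} or ℤ. A matrix whose row and column sums lie in Z
-- never has exactly one entry outside Z in a row or column, so walking alternately along rows and
-- columns through such entries closes up to a cycle with signs ±1 in the kernel. With Z = ℤ this
-- excludes fractional vertices; with Z = {0} it forces circuits to have entries in {0, 1, −1}, and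
-- then maximal steps from integer points end in integer points. If moreover all column sums are 1,
-- integer points are 0/1 and hence vertices, and the points of the polytope supported on
-- supp y ∪ supp y′ for a step y → y′ along g differ from y by kernel vectors supported on supp g,
-- i.e. by multiples of g, so [y, y′] is an edge.
--
-- The three counterexamples go one step along a circuit and back. (a) Two parallel elements and a
-- coloop: (0,0,1) → (½,½,½) along (1,1,−1). (b) A 2 × 3 transportation polytope affinely equal to
-- the rectangle [0,1] × [0,2]: its circuit (−1,1) leads from the corner (1,0) to the non-vertex (0,1).
-- (c) With void size bounds, 2 clusters and 2 items give the unit square, and the row sums turn its
-- diagonal into a circuit.

open import Defs
open import Data.Nat as ℕ using (ℕ; zero; suc)
import Data.Nat.Properties as ℕ
open import Data.Nat.Divisibility using (_∣_; ∣-refl; ∣-reflexive; _∣0; ∣1⇒≡1)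
import Data.Nat.Coprimality as Coprimality
open import Data.Integer as ℤ using (ℤ)
import Data.Integer.Properties as ℤ
open import Data.Rational using
  (ℚ; 0ℚ; 1ℚ; ½; _+_; _*_; -_; _-_; _≤_; _<_; _/_; ↥_; ↧ₙ_; mkℚ; 1/_; positive; ≢-nonZero)
open import Data.Rational.Properties
open import Data.Rational.Solver using (module +-*-Solver)
open import Data.Fin as Fin using (Fin; #_; zero; suc; toℕ; fromℕ<; inject₁; remQuot)
open import Data.Fin.Properties as Fin using (any?; all?; pigeonhole)
open import Data.Fin.Induction using (<-weakInduction)
open import Data.Fin.Subset using (Subset; _∪_; _∩_; ∣_∣)
open import Data.Fin.Subset.Properties using (anySubset?; _⊆?_)
open import Data.Bool using (Bool; true; false; if_then_else_; _∨_)
open import Data.Vec using ([]; _∷_; lookup)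
open import Data.Product using (Σ; ∃; _×_; _,_; proj₁; proj₂)
open import Data.Sum using (_⊎_; inj₁; inj₂; [_,_]′)
open import Data.Empty using (⊥-elim)
open import Function using (_∘_)
open import Relation.Nullary using (¬_; Dec; yes; no; does; contradiction; ¬?; _×-dec_; _⊎-dec_)
open import Relation.Nullary.Decidable using (decidable-stable; from-no; from-yes; True; toWitness)
open import Relation.Unary using (Decidable)
open import Relation.Binary.PropositionalEquality using
  (_≡_; _≢_; refl; sym; trans; cong; cong₂; subst; subst₂; module ≡-Reasoning)
open +-*-Solver using (solve; _:=_; con; _:+_; _:*_; :-_)

-- Finite sums, dot products and unit vectors.

∑-cong : ∀ {n} {f g : Fin n → ℚ} → (∀ j → f j ≡ g j) → ∑ f ≡ ∑ g
∑-cong {zero}  f≗g = refl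
∑-cong {suc n} f≗g = cong₂ _+_ (f≗g zero) (∑-cong (f≗g ∘ suc))

∑-zero : ∀ {n} {f : Fin n → ℚ} → (∀ j → f j ≡ 0ℚ) → ∑ f ≡ 0ℚ
∑-zero {zero}  f≗0 = refl
∑-zero {suc n} f≗0 = cong₂ _+_ (f≗0 zero) (∑-zero (f≗0 ∘ suc))

∑-distrib-+ : ∀ {n} (f g : Fin n → ℚ) → ∑ (λ j → f j + g j) ≡ ∑ f + ∑ g
∑-distrib-+ {zero}  f g = refl
∑-distrib-+ {suc n} f g = trans
  (cong (f zero + g zero +_) (∑-distrib-+ (f ∘ suc) (g ∘ suc)))
  (solve 4 (λ a b c d → (a :+ b) :+ (c :+ d) := (a :+ c) :+ (b :+ d)) refl
    (f zero) (g zero) (∑ (f ∘ suc)) (∑ (g ∘ suc)))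

*-distribˡ-∑ : ∀ {n} c (f : Fin n → ℚ) → ∑ (λ j → c * f j) ≡ c * ∑ f
*-distribˡ-∑ {zero}  c f = sym (*-zeroʳ c)
*-distribˡ-∑ {suc n} c f = trans
  (cong (c * f zero +_) (*-distribˡ-∑ c (f ∘ suc)))
  (sym (*-distribˡ-+ c (f zero) (∑ (f ∘ suc))))

∑-nonneg : ∀ {n} {f : Fin n → ℚ} → (∀ j → 0ℚ ≤ f j) → 0ℚ ≤ ∑ f
∑-nonneg {zero}  f≥0 = ≤-refl
∑-nonneg {suc n} f≥0 = +-mono-≤ (f≥0 zero) (∑-nonneg (f≥0 ∘ suc))

p≤p+q : ∀ p {q} → 0ℚ ≤ q → p ≤ p + q
p≤p+q p {q} q≥0 = subst (_≤ p + q) (+-identityʳ p) (+-monoʳ-≤ p q≥0)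

q≤p+q : ∀ {p} q → 0ℚ ≤ p → q ≤ p + q
q≤p+q {p} q p≥0 = subst (_≤ p + q) (+-identityˡ q) (+-monoˡ-≤ q p≥0)

term≤∑ : ∀ {n} {f : Fin n → ℚ} → (∀ j → 0ℚ ≤ f j) → ∀ p → f p ≤ ∑ f
term≤∑ {f = f} f≥0 zero    = p≤p+q (f zero) (∑-nonneg (f≥0 ∘ suc))
term≤∑ {f = f} f≥0 (suc p) =
  ≤-trans (term≤∑ (f≥0 ∘ suc) p) (q≤p+q (∑ (f ∘ suc)) (f≥0 zero))

two-terms≤∑ : ∀ {n} {f : Fin n → ℚ} → (∀ j → 0ℚ ≤ f j) → ∀ p q → p ≢ q → f p + f q ≤ ∑ f
two-terms≤∑ f≥0 zero    zero    p≢q = contradiction refl p≢q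
two-terms≤∑ {f = f} f≥0 zero (suc q) p≢q = +-monoʳ-≤ (f zero) (term≤∑ (f≥0 ∘ suc) q)
two-terms≤∑ {f = f} f≥0 (suc p) zero p≢q = subst (_≤ ∑ f) (+-comm (f zero) (f (suc p)))
  (+-monoʳ-≤ (f zero) (term≤∑ (f≥0 ∘ suc) p))
two-terms≤∑ {f = f} f≥0 (suc p) (suc q) p≢q = ≤-trans
  (two-terms≤∑ (f≥0 ∘ suc) p q (p≢q ∘ cong suc)) (q≤p+q (∑ (f ∘ suc)) (f≥0 zero))

∑-single : ∀ {n} {f : Fin n → ℚ} p → (∀ q → q ≢ p → f q ≡ 0ℚ) → ∑ f ≡ f p
∑-single {f = f} zero f≗0 =
  trans (cong (f zero +_) (∑-zero (λ q → f≗0 (suc q) (λ ())))) (+-identityʳ (f zero))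
∑-single {f = f} (suc p) f≗0 = trans
  (cong₂ _+_ (f≗0 zero (λ ())) (∑-single p (λ q q≢p → f≗0 (suc q) (q≢p ∘ Fin.suc-injective))))
  (+-identityˡ (f (suc p)))

·-congʳ : ∀ {n} (a : Vec℘ n) {x y : Vec℘ n} → x ≈ y → a · x ≡ a · y
·-congʳ a x≈y = ∑-cong (λ j → cong (a j *_) (x≈y j))

·-congˡ : ∀ {n} {a b : Vec℘ n} (x : Vec℘ n) → a ≈ b → a · x ≡ b · x
·-congˡ x a≈b = ∑-cong (λ j → cong (_* x j) (a≈b j))

·-+ᵥ : ∀ {n} (a x y : Vec℘ n) → a · (x +ᵥ y) ≡ a · x + a · y
·-+ᵥ a x y = trans (∑-cong (λ j → *-distribˡ-+ (a j) (x j) (y j))) 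
  (∑-distrib-+ (λ j → a j * x j) (λ j → a j * y j))

·-*ᵥ : ∀ {n} (a : Vec℘ n) c (x : Vec℘ n) → a · (c *ᵥ x) ≡ c * (a · x)
·-*ᵥ a c x = trans
  (∑-cong (λ j → solve 3 (λ a c x → a :* (c :* x) := c :* (a :* x)) refl (a j) c (x j)))
  (*-distribˡ-∑ c (λ j → a j * x j))

*ᵥ-· : ∀ {n} c (a x : Vec℘ n) → (c *ᵥ a) · x ≡ c * (a · x)
*ᵥ-· c a x = trans (∑-cong (λ j → *-assoc c (a j) (x j))) (*-distribˡ-∑ c (λ j → a j * x j))

·-comm : ∀ {n} (a x : Vec℘ n) → a · x ≡ x · a
·-comm a x = ∑-cong (λ j → *-comm (a j) (x j))

unit-same : ∀ {n} (p : Fin n) → unit p p ≡ 1ℚ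
unit-same p with p Fin.≟ p
... | yes _  = refl
... | no p≢p = contradiction refl p≢p

unit-other : ∀ {n} {p q : Fin n} → p ≢ q → unit p q ≡ 0ℚ
unit-other {p = p} {q} p≢q with p Fin.≟ q
... | yes p≡q = contradiction p≡q p≢q
... | no _    = refl

·-unit : ∀ {n} (a : Vec℘ n) p → a · unit p ≡ a p
·-unit a p = trans
  (∑-single p (λ q q≢p → trans (cong (a q *_) (unit-other (q≢p ∘ sym))) (*-zeroʳ (a q))))
  (trans (cong (a p *_) (unit-same p)) (*-identityʳ (a p)))

unit-· : ∀ {n} p (x : Vec℘ n) → unit p · x ≡ x p
unit-· p x = trans (·-comm (unit p) x) (·-unit x p)

-unit-· : ∀ {n} p (x : Vec℘ n) → ((- 1ℚ) *ᵥ unit p) · x ≡ - x p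
-unit-· p x = trans (*ᵥ-· (- 1ℚ) (unit p) x)
  (trans (cong (- 1ℚ *_) (unit-· p x)) (solve 1 (λ a → con (- 1ℚ) :* a := :- a) refl (x p)))

-- Integer rationals and the values 0, 1, -1.

IsInteger? : Decidable IsIntegerℚ
IsInteger? q = ↧ₙ q ℕ.≟ 1

/1-integer : ∀ z → IsIntegerℚ (z / 1)
/1-integer (ℤ.+ n)    = cong ↧ₙ_ (normalize-coprime (Coprimality.sym (Coprimality.1-coprimeTo n)))
/1-integer ℤ.-[1+ n ] =
  cong (λ q → ↧ₙ (- q)) (normalize-coprime (Coprimality.sym (Coprimality.1-coprimeTo (suc n))))

+-integer : ∀ p q → IsIntegerℚ p → IsIntegerℚ q → IsIntegerℚ (p + q)
+-integer (mkℚ z 0 _) (mkℚ w 0 _) refl refl = /1-integer (z ℤ.* ℤ.1ℤ ℤ.+ w ℤ.* ℤ.1ℤ)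

*-integer : ∀ p q → IsIntegerℚ p → IsIntegerℚ q → IsIntegerℚ (p * q)
*-integer (mkℚ z 0 _) (mkℚ w 0 _) refl refl = /1-integer (z ℤ.* w)

neg-integer : ∀ q → IsIntegerℚ q → IsIntegerℚ (- q)
neg-integer (mkℚ ℤ.-[1+ _ ]  0 _) refl = refl
neg-integer (mkℚ (ℤ.+ zero)  0 _) refl = refl
neg-integer (mkℚ (ℤ.+ suc _) 0 _) refl = refl

integer-0≤q≤1 : ∀ q → IsIntegerℚ q → 0ℚ ≤ q → q ≤ 1ℚ → q ≡ 0ℚ ⊎ q ≡ 1ℚ
integer-0≤q≤1 (mkℚ ℤ.-[1+ _ ] 0 _) refl q≥0 q≤1 with () ← drop-*≤* q≥0
integer-0≤q≤1 (mkℚ (ℤ.+ 0) 0 _) refl q≥0 q≤1 = inj₁ refl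
integer-0≤q≤1 (mkℚ (ℤ.+ 1) 0 _) refl q≥0 q≤1 = inj₂ refl
integer-0≤q≤1 (mkℚ (ℤ.+ suc (suc _)) 0 _) refl q≥0 q≤1 with ℤ.+≤+ (ℕ.s≤s ()) ← drop-*≤* q≤1

-- The values allowed for the entries of a circuit and, in the rigidity argument, for the change of
-- an inequality row along a direction.
Ternary : ℚ → Set
Ternary q = q ≡ 0ℚ ⊎ q ≡ 1ℚ ⊎ q ≡ - 1ℚ

ternary-integer : ∀ {q} → Ternary q → IsIntegerℚ q
ternary-integer (inj₁ refl)        = refl
ternary-integer (inj₂ (inj₁ refl)) = refl
ternary-integer (inj₂ (inj₂ refl)) = refl

ternary-neg : ∀ {q} → Ternary q → Ternary (- q)
ternary-neg (inj₁ refl)        = inj₁ refl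
ternary-neg (inj₂ (inj₁ refl)) = inj₂ (inj₂ refl)
ternary-neg (inj₂ (inj₂ refl)) = inj₂ (inj₁ refl)

ternary-* : ∀ {p q} → Ternary p → Ternary q → Ternary (p * q)
ternary-* {q = q} (inj₁ refl) _ = inj₁ (*-zeroˡ q)
ternary-* {q = q} (inj₂ (inj₁ refl)) t = subst Ternary (sym (*-identityˡ q)) t
ternary-* (inj₂ (inj₂ refl)) (inj₁ refl)        = inj₁ refl
ternary-* (inj₂ (inj₂ refl)) (inj₂ (inj₁ refl)) = inj₂ (inj₂ refl)
ternary-* (inj₂ (inj₂ refl)) (inj₂ (inj₂ refl)) = inj₂ (inj₁ refl)

-- A nonzero ternary number is its own inverse, so later divisions by an entry become
-- multiplications by it.
ternary-square : ∀ {q} → Ternary q → q ≢ 0ℚ → q * q ≡ 1ℚ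
ternary-square (inj₁ q≡0)         q≢0 = contradiction q≡0 q≢0
ternary-square (inj₂ (inj₁ refl)) q≢0 = refl
ternary-square (inj₂ (inj₂ refl)) q≢0 = refl

∣↥q∣≡1⇒ternary : ∀ q → IsIntegerℚ q → ℤ.∣ ↥ q ∣ ≡ 1 → Ternary q
∣↥q∣≡1⇒ternary (mkℚ (ℤ.+ 1)    0 _) refl refl = inj₂ (inj₁ refl)
∣↥q∣≡1⇒ternary (mkℚ ℤ.-[1+ 0 ] 0 _) refl refl = inj₂ (inj₂ refl)

-- Row and column sums with values in a subgroup of ℚ.

-- Treating `Z` abstractly lets one cycle construction serve both ℤ and {0}. Membership is decidable
-- so that a second entry outside `Z` can be searched for.
record Subgroup (Z : ℚ → Set) : Set where
  field
    0∈  : Z 0ℚ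
    +∈  : ∀ {p q} → Z p → Z q → Z (p + q)
    -∈  : ∀ {q} → Z q → Z (- q)
    _∈? : Decidable Z

integers : Subgroup IsIntegerℚ
integers = record
  { 0∈ = refl ; +∈ = λ {p q} → +-integer p q ; -∈ = λ {q} → neg-integer q ; _∈? = IsInteger? }

zeroSubgroup : Subgroup (_≡ 0ℚ)
zeroSubgroup = record
  { 0∈ = refl ; +∈ = cong₂ _+_ ; -∈ = cong (λ q → - q) ; _∈? = λ q → q ≟ 0ℚ }

module _ {Z : ℚ → Set} (G : Subgroup Z) where
  open Subgroup G

  ∑∈ : ∀ {n} {f : Fin n → ℚ} → (∀ j → Z (f j)) → Z (∑ f)
  ∑∈ {zero}  f∈ = 0∈
  ∑∈ {suc n} f∈ = +∈ (f∈ zero) (∑∈ (f∈ ∘ suc))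

  -- The term at `q` is the total minus the other terms, all of which lie in `Z`.
  term∈ : ∀ {n} {f : Fin n → ℚ} q → (∀ p → p ≢ q → Z (f p)) → Z (∑ f) → Z (f q)
  term∈ {f = f} zero f∈ ∑f∈ = subst Z
    (solve 2 (λ a b → (a :+ b) :+ (:- b) := a) refl (f zero) (∑ (f ∘ suc)))
    (+∈ ∑f∈ (-∈ (∑∈ (λ p → f∈ (suc p) (λ ())))))
  term∈ {f = f} (suc q) f∈ ∑f∈ = term∈ q (λ p p≢q → f∈ (suc p) (p≢q ∘ Fin.suc-injective))
    (subst Z (solve 2 (λ a b → (a :+ b) :+ (:- a) := b) refl (f zero) (∑ (f ∘ suc)))
      (+∈ ∑f∈ (-∈ (f∈ zero (λ ())))))

-- With `rowOf` or `columnOf` for `h` this unfolds to `rowSel` or `colSel`; the general form lets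
-- rows and columns share their lemmas.
sel : ∀ {m n} → (Fin n → Fin m) → Fin m → Vec℘ n
sel h i q = if does (h q Fin.≟ i) then 1ℚ else 0ℚ

sel-cong : ∀ {m n} (h : Fin n → Fin m) i {p q} → h p ≡ h q → sel h i p ≡ sel h i q
sel-cong h i = cong (λ l → if does (l Fin.≟ i) then 1ℚ else 0ℚ)

sel-1 : ∀ {m n} (h : Fin n → Fin m) {i q} → h q ≡ i → sel h i q ≡ 1ℚ
sel-1 h {i} {q} hq≡i with h q Fin.≟ i
... | yes _  = refl
... | no hq≢i = contradiction hq≡i hq≢i

sel-nonneg : ∀ {m n} (h : Fin n → Fin m) i {x : Vec℘ n} → (∀ q → 0ℚ ≤ x q) → ∀ q → 0ℚ ≤ sel h i q * x q
sel-nonneg h i {x} x≥0 q with does (h q Fin.≟ i)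
... | true  = subst (0ℚ ≤_) (sym (*-identityˡ (x q))) (x≥0 q)
... | false = ≤-reflexive (sym (*-zeroˡ (x q)))

own-term : ∀ {m n} (h : Fin n → Fin m) (x : Vec℘ n) {p q} → h p ≡ h q → sel h (h q) p * x p ≡ x p
own-term h x {p} hp≡hq = trans (cong (_* x p) (sel-1 h hp≡hq)) (*-identityˡ (x p))

entry≤class-sum : ∀ {m n} (h : Fin n → Fin m) {x : Vec℘ n} → (∀ q → 0ℚ ≤ x q) →
                  ∀ q → x q ≤ sel h (h q) · x
entry≤class-sum h {x} x≥0 q =
  subst (_≤ sel h (h q) · x) (own-term h x refl) (term≤∑ (sel-nonneg h (h q) x≥0) q)

-- If `q` were the only entry of its class outside `Z`, then `term∈` would put it into `Z`. This
-- supplies each move of the alternating walk.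
another : ∀ {Z m n} → Subgroup Z → (h : Fin n → Fin m) (x : Vec℘ n) →
          (∀ i → Z (sel h i · x)) → ∀ q → ¬ Z (x q) →
          ∃ λ p → p ≢ q × h p ≡ h q × ¬ Z (x p)
another {Z} G h x sums∈ q xq∉ with
  any? (λ p → ¬? (p Fin.≟ q) ×-dec (h p Fin.≟ h q) ×-dec ¬? (Subgroup._∈? G (x p)))
... | yes found = found
... | no none = contradiction
  (subst Z (own-term h x refl) (term∈ G q others∈ (sums∈ (h q)))) xq∉
  where
  open Subgroup G
  others∈ : ∀ p → p ≢ q → Z (sel h (h q) p * x p)
  others∈ p p≢q with h p Fin.≟ h q
  ... | no _     = subst Z (sym (*-zeroˡ (x p))) 0∈
  ... | yes hp≡hq = subst Z (sym (*-identityˡ (x p)))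
    (decidable-stable (x p ∈?) (λ xp∉ → none (p , p≢q , hp≡hq , xp∉)))

-- Alternating cycles through the cells of a grid.

-- Indices are scanned until a value recurs, and the pigeonhole principle stops the scan. Taking the
-- first recurrence keeps all earlier values distinct, which makes the cycle simple in its columns.
first-repetition : ∀ {n} (f : ℕ → Fin n) →
  ∃ λ s → ∃ λ t → s ℕ.< t × f s ≡ f t × (∀ i j → i ℕ.< j → j ℕ.< t → f i ≢ f j)
first-repetition {n} f = [ (λ r → r) , ⊥-elim ∘ impossible ]′ (search (suc n))
  where
  search : ∀ t →
    (∃ λ s → ∃ λ t → s ℕ.< t × f s ≡ f t × (∀ i j → i ℕ.< j → j ℕ.< t → f i ≢ f j))
    ⊎ (∀ i j → i ℕ.< j → j ℕ.< t → f i ≢ f j)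
  search zero = inj₂ (λ _ _ _ ())
  search (suc t) with search t
  ... | inj₁ r = inj₁ r
  ... | inj₂ distinct with any? (λ (s : Fin t) → f (toℕ s) Fin.≟ f t)
  ... | yes (s , fs≡ft) = inj₁ (toℕ s , t , Fin.toℕ<n s , fs≡ft , distinct)
  ... | no fresh = inj₂ extend
    where
    extend : ∀ i j → i ℕ.< j → j ℕ.< suc t → f i ≢ f j
    extend i j i<j j<1+t with ℕ.m<1+n⇒m<n∨m≡n j<1+t
    ... | inj₁ j<t  = distinct i j i<j j<t
    ... | inj₂ refl = λ fi≡ft → fresh
      (fromℕ< i<j , trans (cong f (Fin.toℕ-fromℕ< i<j)) fi≡ft)
  impossible : ¬ (∀ i j → i ℕ.< j → j ℕ.< suc n → f i ≢ f j)
  impossible distinct with pigeonhole (ℕ.n<1+n n) (f ∘ toℕ)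
  ... | i , j , i<j , fi≡fj = distinct (toℕ i) (toℕ j) i<j (Fin.toℕ<n j) fi≡fj

-- Counts the visits of `d 0`, ..., `d (l - 1)` to each cell.
trail : ∀ {n} → (ℕ → Fin n) → ℕ → Vec℘ n
trail d zero    q = 0ℚ
trail d (suc l) q = trail d l q + unit (d l) q

-- Without repetitions every count is 0 or 1. The visiting index is kept, because the support and
-- the nonvanishing of the cycle are read off from it.
trail-values : ∀ {n} (d : ℕ → Fin n) l → (∀ i j → i ℕ.< j → j ℕ.< l → d i ≢ d j) → ∀ q →
  (trail d l q ≡ 0ℚ × (∀ i → i ℕ.< l → d i ≢ q)) ⊎ (trail d l q ≡ 1ℚ × ∃ λ i → i ℕ.< l × d i ≡ q)
trail-values d zero distinct q = inj₁ (refl , λ _ ())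
trail-values d (suc l) distinct q
  with trail-values d l (λ i j i<j j<l → distinct i j i<j (ℕ.m<n⇒m<1+n j<l)) q | d l Fin.≟ q
... | inj₁ (t≡0 , _) | yes dl≡q = inj₂ (cong (_+ 1ℚ) t≡0 , l , ℕ.n<1+n l , dl≡q)
... | inj₂ (_ , i , i<l , di≡q) | yes dl≡q =
  contradiction (trans di≡q (sym dl≡q)) (distinct i l i<l (ℕ.n<1+n l))
... | inj₂ (t≡1 , i , i<l , di≡q) | no _ =
  inj₂ (cong (_+ 0ℚ) t≡1 , i , ℕ.m<n⇒m<1+n i<l , di≡q)
... | inj₁ (t≡0 , miss) | no dl≢q = inj₁ (cong (_+ 0ℚ) t≡0 , miss′)
  where
  miss′ : ∀ i → i ℕ.< suc l → d i ≢ q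
  miss′ i i<1+l with ℕ.m<1+n⇒m<n∨m≡n i<1+l
  ... | inj₁ i<l  = miss i i<l
  ... | inj₂ refl = dl≢q

-- A closed trail alternating between rows and columns, cut at its first repeated column, carries
-- the signs +1 and −1 alternately; its row and column sums then telescope to zero.
module AlternatingCycle {k m n} (r : Fin k → Fin m) (c : Fin k → Fin n) (S : Fin k → Set)
  (rc-injective : ∀ {p q} → r p ≡ r q → c p ≡ c q → p ≡ q)
  (R : ∀ q → S q → ∃ λ p → p ≢ q × r p ≡ r q × S p)
  (C : ∀ q → S q → ∃ λ p → p ≢ q × c p ≡ c q × S p)
  (start : ∃ S) where

  along-row along-column : ∃ S → ∃ S
  along-row (q , q∈S) with R q q∈S
  ... | p , _ , _ , p∈S = p , p∈S
  along-column (q , q∈S) with C q q∈S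
  ... | p , _ , _ , p∈S = p , p∈S

  walk : ℕ → ∃ S
  walk zero    = start
  walk (suc l) = along-column (along-row (walk l))

  -- `a l` and `b l` share a row, while `b l` and `a (suc l)` share a column. The cycle will carry
  -- +1 on the cells `a` and -1 on the cells `b`.
  a b : ℕ → Fin k
  a l = proj₁ (walk l)
  b l = proj₁ (along-row (walk l))

  b≢a : ∀ l → b l ≢ a l
  b≢a l = proj₁ (proj₂ (R (a l) (proj₂ (walk l))))

  rb≡ra : ∀ l → r (b l) ≡ r (a l)
  rb≡ra l = proj₁ (proj₂ (proj₂ (R (a l) (proj₂ (walk l)))))

  a≢b : ∀ l → a (suc l) ≢ b l
  a≢b l = proj₁ (proj₂ (C (b l) (proj₂ (along-row (walk l)))))

  ca≡cb : ∀ l → c (a (suc l)) ≡ c (b l)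
  ca≡cb l = proj₁ (proj₂ (proj₂ (C (b l) (proj₂ (along-row (walk l))))))

  -- The cycle uses the `suc L` row moves from index `s` on. Closing up concerns only columns: the
  -- last `b` shares its column with the first `a`, which is all that the column sums require.
  module Closed (s L : ℕ) (closes : c (a s) ≡ c (a (suc L ℕ.+ s)))
    (distinct : ∀ i j → i ℕ.< j → j ℕ.< suc L → c (a (i ℕ.+ s)) ≢ c (a (j ℕ.+ s))) where

    A B : ℕ → Fin k
    A i = a (i ℕ.+ s)
    B i = b (i ℕ.+ s)

    A-distinct : ∀ i j → i ℕ.< j → j ℕ.< suc L → A i ≢ A j
    A-distinct i j i<j j<1+L Ai≡Aj = distinct i j i<j j<1+L (cong c Ai≡Aj)

    -- Shifting the indices by one leaves the range of `distinct` only at the last index, where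
    -- `closes` wraps the column around to that of `A 0`. As `B i` lies in the column of
    -- `A (suc i)`, this yields `B-distinct`.
    next-column-distinct : ∀ i j → i ℕ.< j → j ℕ.< suc L → c (A (suc i)) ≢ c (A (suc j))
    next-column-distinct i j i<j j<1+L eq with ℕ.m<1+n⇒m<n∨m≡n j<1+L
    ... | inj₁ j<L  = distinct (suc i) (suc j) (ℕ.s≤s i<j) (ℕ.s≤s j<L) eq
    ... | inj₂ refl = distinct 0 (suc i) (ℕ.s≤s ℕ.z≤n) (ℕ.s≤s i<j) (trans closes (sym eq))

    B-distinct : ∀ i j → i ℕ.< j → j ℕ.< suc L → B i ≢ B j
    B-distinct i j i<j j<1+L Bi≡Bj = next-column-distinct i j i<j j<1+L
      (trans (ca≡cb (i ℕ.+ s)) (trans (cong c Bi≡Bj) (sym (ca≡cb (j ℕ.+ s)))))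

    alternating : ℕ → Vec℘ k
    alternating l = trail A l +ᵥ ((- 1ℚ) *ᵥ trail B l)

    ·-alternating : ∀ v l → v · alternating (suc l) ≡ v · alternating l + (v (A l) - v (B l))
    ·-alternating v l = begin
      v · alternating (suc l)
        ≡⟨ ·-congʳ v (λ q → solve 4
             (λ t u t′ u′ → (t :+ u) :+ con (- 1ℚ) :* (t′ :+ u′)
                         := (t :+ con (- 1ℚ) :* t′) :+ (u :+ con (- 1ℚ) :* u′)) refl
             (trail A l q) (unit (A l) q) (trail B l q) (unit (B l) q)) ⟩
      v · (alternating l +ᵥ (unit (A l) +ᵥ ((- 1ℚ) *ᵥ unit (B l))))
        ≡⟨ ·-+ᵥ v (alternating l) (unit (A l) +ᵥ ((- 1ℚ) *ᵥ unit (B l))) ⟩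
      v · alternating l + v · (unit (A l) +ᵥ ((- 1ℚ) *ᵥ unit (B l)))
        ≡⟨ cong (v · alternating l +_) (·-+ᵥ v (unit (A l)) ((- 1ℚ) *ᵥ unit (B l))) ⟩
      v · alternating l + (v · unit (A l) + v · ((- 1ℚ) *ᵥ unit (B l)))
        ≡⟨ cong (λ t → v · alternating l + (v · unit (A l) + t)) (·-*ᵥ v (- 1ℚ) (unit (B l))) ⟩
      v · alternating l + (v · unit (A l) + - 1ℚ * (v · unit (B l)))
        ≡⟨ cong₂ (λ t u → v · alternating l + (t + - 1ℚ * u)) (·-unit v (A l)) (·-unit v (B l)) ⟩
      v · alternating l + (v (A l) + - 1ℚ * v (B l))
        ≡⟨ solve 3 (λ t u w → t :+ (u :+ con (- 1ℚ) :* w) := t :+ (u :+ :- w)) refl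
             (v · alternating l) (v (A l)) (v (B l)) ⟩
      v · alternating l + (v (A l) - v (B l)) ∎
      where open ≡-Reasoning

    ·-alternating-0 : ∀ v → v · alternating 0 ≡ 0ℚ
    ·-alternating-0 v = ∑-zero (λ q → *-zeroʳ (v q))

    row-sum : ∀ i l → sel r i · alternating l ≡ 0ℚ
    row-sum i zero    = ·-alternating-0 (sel r i)
    row-sum i (suc l) = begin
      sel r i · alternating (suc l)
        ≡⟨ ·-alternating (sel r i) l ⟩
      sel r i · alternating l + (sel r i (A l) - sel r i (B l))
        ≡⟨ cong₂ (λ t u → t + (sel r i (A l) - u)) (row-sum i l) (sel-cong r i (rb≡ra (l ℕ.+ s))) ⟩
      0ℚ + (sel r i (A l) - sel r i (A l))
        ≡⟨ solve 1 (λ t → con 0ℚ :+ (t :+ :- t) := con 0ℚ) refl (sel r i (A l)) ⟩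
      0ℚ ∎
      where open ≡-Reasoning

    -- `B l` cancels against `A (suc l)` in their common column, so only the two ends survive;
    -- `closes` identifies these at `suc L`.
    column-sum : ∀ j l → sel c j · alternating l ≡ sel c j (A 0) - sel c j (A l)
    column-sum j zero    = trans (·-alternating-0 (sel c j)) (sym (+-inverseʳ (sel c j (A 0))))
    column-sum j (suc l) = begin
      sel c j · alternating (suc l)
        ≡⟨ ·-alternating (sel c j) l ⟩
      sel c j · alternating l + (sel c j (A l) - sel c j (B l))
        ≡⟨ cong₂ (λ t u → t + (sel c j (A l) - u)) (column-sum j l)
             (sel-cong c j (sym (ca≡cb (l ℕ.+ s)))) ⟩
      (sel c j (A 0) - sel c j (A l)) + (sel c j (A l) - sel c j (A (suc l)))
        ≡⟨ solve 3 (λ t u w → (t :+ :- u) :+ (u :+ :- w) := t :+ :- w) refl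
             (sel c j (A 0)) (sel c j (A l)) (sel c j (A (suc l))) ⟩
      sel c j (A 0) - sel c j (A (suc l)) ∎
      where open ≡-Reasoning

    g : Vec℘ k
    g = alternating (suc L)

    g-columns : ∀ j → sel c j · g ≡ 0ℚ
    g-columns j = trans (column-sum j (suc L))
      (trans (cong (λ t → sel c j (A 0) - t) (sel-cong c j (sym closes)))
        (+-inverseʳ (sel c j (A 0))))

    g-ternary : ∀ q → Ternary (g q)
    g-ternary q with trail-values A (suc L) A-distinct q | trail-values B (suc L) B-distinct q
    ... | inj₁ (t≡0 , _) | inj₁ (u≡0 , _) = inj₁ (cong₂ (λ t u → t + - 1ℚ * u) t≡0 u≡0)
    ... | inj₁ (t≡0 , _) | inj₂ (u≡1 , _) = inj₂ (inj₂ (cong₂ (λ t u → t + - 1ℚ * u) t≡0 u≡1))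
    ... | inj₂ (t≡1 , _) | inj₁ (u≡0 , _) = inj₂ (inj₁ (cong₂ (λ t u → t + - 1ℚ * u) t≡1 u≡0))
    ... | inj₂ (t≡1 , _) | inj₂ (u≡1 , _) = inj₁ (cong₂ (λ t u → t + - 1ℚ * u) t≡1 u≡1)

    g-support : ∀ q → g q ≢ 0ℚ → S q
    g-support q g≢0 with trail-values A (suc L) A-distinct q | trail-values B (suc L) B-distinct q
    ... | inj₁ (t≡0 , _) | inj₁ (u≡0 , _) =
      contradiction (cong₂ (λ t u → t + - 1ℚ * u) t≡0 u≡0) g≢0
    ... | inj₁ _ | inj₂ (_ , i , _ , refl) = proj₂ (along-row (walk (i ℕ.+ s)))
    ... | inj₂ (_ , i , _ , refl) | _      = proj₂ (walk (i ℕ.+ s))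

    -- For `L = 0` the cells `a s` and `b s` would agree in row and in column, hence be equal.
    0<L : 0 ℕ.< L
    0<L = ℕ.n≢0⇒n>0 (λ L≡0 → b≢a s (rc-injective (rb≡ra s)
      (trans (sym (ca≡cb s)) (sym (subst (λ l → c (a s) ≡ c (a (suc l ℕ.+ s))) L≡0 closes)))))

    -- An `A` cell may coincide with a `B` cell and cancel, so `g` is not visibly nonzero. `A 1` is
    -- safe: `B 0` differs from it by the choice of the column move, and every later `B` lies in
    -- another column.
    B-misses-A1 : ∀ i → i ℕ.< suc L → B i ≢ A 1
    B-misses-A1 zero    i<1+L eq = a≢b s (sym eq)
    B-misses-A1 (suc i) i<1+L eq = next-column-distinct 0 (suc i) (ℕ.s≤s ℕ.z≤n) i<1+L
      (trans (cong c (sym eq)) (sym (ca≡cb (suc i ℕ.+ s))))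

    g-nonzero : g (A 1) ≢ 0ℚ
    g-nonzero g≡0
      with trail-values A (suc L) A-distinct (A 1) | trail-values B (suc L) B-distinct (A 1)
    ... | inj₁ (_ , miss) | _ = miss 1 (ℕ.s≤s 0<L) refl
    ... | inj₂ _ | inj₂ (_ , i , i<1+L , Bi≡A1) = B-misses-A1 i i<1+L Bi≡A1
    ... | inj₂ (t≡1 , _) | inj₁ (u≡0 , _)
      with () ← trans (sym g≡0) (cong₂ (λ t u → t + - 1ℚ * u) t≡1 u≡0)

  alternating-cycle : ∃ λ g → (∀ i → sel r i · g ≡ 0ℚ) × (∀ j → sel c j · g ≡ 0ℚ) ×
    (∀ q → Ternary (g q)) × (∃ λ q → g q ≢ 0ℚ) × (∀ q → g q ≢ 0ℚ → S q)
  alternating-cycle with first-repetition (c ∘ a)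
  -- From `s < t`, that is `suc s ≤ t`, comes `L` with `suc s + L = t`; the cycle then has
  -- `t - s = suc L` row moves.
  ... | s , t , s<t , cas≡cat , distinct with ℕ.m≤n⇒∃[o]m+o≡n s<t
  ... | L , refl = g , (λ i → row-sum i (suc L)) , g-columns , g-ternary , (A 1 , g-nonzero) , g-support
    where
    open Closed s L (trans cas≡cat (cong (λ l → c (a (suc l))) (ℕ.+-comm s L)))
      (λ i j i<j j<1+L → distinct (i ℕ.+ s) (j ℕ.+ s) (ℕ.+-monoˡ-< s i<j)
        (subst (j ℕ.+ s ℕ.<_) (cong suc (ℕ.+-comm L s)) (ℕ.+-monoˡ-< s j<1+L)))

-- Order lemmas and rigidity of vertices.

p≤q⇒0≤q-p : ∀ {p q} → p ≤ q → 0ℚ ≤ q - p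
p≤q⇒0≤q-p {p} {q} p≤q = subst (_≤ q - p) (+-inverseʳ p) (+-monoˡ-≤ (- p) p≤q)

0≤q-p⇒p≤q : ∀ {p q} → 0ℚ ≤ q - p → p ≤ q
0≤q-p⇒p≤q {p} {q} 0≤q-p = subst₂ _≤_ (+-identityˡ p)
  (solve 2 (λ q p → (q :+ :- p) :+ p := q) refl q p) (+-monoˡ-≤ p 0≤q-p)

p+q≡p⇒q≡0 : ∀ p q → p + q ≡ p → q ≡ 0ℚ
p+q≡p⇒q≡0 p q p+q≡p = begin
  q            ≡⟨ solve 2 (λ p q → q := (p :+ q) :+ :- p) refl p q ⟩
  (p + q) - p  ≡⟨ cong (_- p) p+q≡p ⟩
  p - p        ≡⟨ +-inverseʳ p ⟩
  0ℚ           ∎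
  where open ≡-Reasoning

-p≡0⇒p≡0 : ∀ p → - p ≡ 0ℚ → p ≡ 0ℚ
-p≡0⇒p≡0 p -p≡0 = neg-injective -p≡0

p≢0∧p*q≡0⇒q≡0 : ∀ p q → p ≢ 0ℚ → p * q ≡ 0ℚ → q ≡ 0ℚ
p≢0∧p*q≡0⇒q≡0 p q p≢0 pq≡0 = begin
  q               ≡⟨ sym (*-identityˡ q) ⟩
  1ℚ * q          ≡⟨ cong (_* q) (sym (*-inverseˡ p)) ⟩
  (1/ p * p) * q  ≡⟨ *-assoc (1/ p) p q ⟩
  1/ p * (p * q)  ≡⟨ cong (1/ p *_) pq≡0 ⟩
  1/ p * 0ℚ       ≡⟨ *-zeroʳ (1/ p) ⟩
  0ℚ              ∎
  where
  open ≡-Reasoning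
  instance p-nonZero = ≢-nonZero p≢0

-- `ε` is the minimum of 1 and the positive entries; it serves as one step length that is safe in
-- all slack coordinates at once.
positive-gap : ∀ {n} (w : Vec℘ n) → (∀ q → 0ℚ ≤ w q) →
               ∃ λ ε → 0ℚ < ε × (∀ q → w q ≡ 0ℚ ⊎ ε ≤ w q)
positive-gap {zero}  w w≥0 = 1ℚ , positive⁻¹ 1ℚ , λ ()
positive-gap {suc n} w w≥0 with positive-gap (w ∘ suc) (w≥0 ∘ suc) | w zero ≟ 0ℚ
... | ε , ε>0 , gap | yes w₀≡0 = ε , ε>0 , λ { zero → inj₁ w₀≡0 ; (suc q) → gap q }
... | ε , ε>0 , gap | no w₀≢0 with ≤-total ε (w zero)
... | inj₁ ε≤w₀ = ε , ε>0 , λ { zero → inj₂ ε≤w₀ ; (suc q) → gap q }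
... | inj₂ w₀≤ε = w zero , ≰⇒> (λ w₀≤0 → w₀≢0 (≤-antisym w₀≤0 (w≥0 zero))) ,
  λ { zero → inj₂ ≤-refl ; (suc q) → [ inj₁ , inj₂ ∘ ≤-trans w₀≤ε ]′ (gap q) }

-- Only the value -1 lowers `w`, and it lowers it by exactly `ε`: the gap pays for this when `w` is
-- positive, and `ok` excludes it when `w` is zero.
ternary-shift-nonneg : ∀ {ε} w g → 0ℚ ≤ ε → w ≡ 0ℚ ⊎ ε ≤ w → 0ℚ ≤ w → Ternary g →
                       (w ≡ 0ℚ → g ≢ - 1ℚ) → 0ℚ ≤ w + ε * g
ternary-shift-nonneg {ε} w _ ε≥0 gap w≥0 (inj₁ refl) ok =
  subst (0ℚ ≤_) (solve 2 (λ w ε → w := w :+ ε :* con 0ℚ) refl w ε) w≥0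
ternary-shift-nonneg {ε} w _ ε≥0 gap w≥0 (inj₂ (inj₁ refl)) ok =
  subst (0ℚ ≤_) (solve 2 (λ w ε → w :+ ε := w :+ ε :* con 1ℚ) refl w ε) (+-mono-≤ w≥0 ε≥0)
ternary-shift-nonneg w _ ε≥0 (inj₁ w≡0) w≥0 (inj₂ (inj₂ refl)) ok = contradiction refl (ok w≡0)
ternary-shift-nonneg {ε} w _ ε≥0 (inj₂ ε≤w) w≥0 (inj₂ (inj₂ refl)) ok =
  subst (0ℚ ≤_) (solve 2 (λ w ε → w :+ :- ε := w :+ ε :* con (- 1ℚ)) refl w ε) (p≤q⇒0≤q-p ε≤w)

-- The functional exposing `v` takes the values `δ + c · x` and `δ - c · x` at the two points.
-- Neither exceeds `δ`, so both equal `δ`, and uniqueness of the maximiser applies.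
vertex-rigid : ∀ {n} {P : Polyhedron n} {v : Vec℘ n} (x : Vec℘ n) → IsVertex P v →
               _∈P P (v +ᵥ x) → _∈P P (v +ᵥ ((- 1ℚ) *ᵥ x)) → ∀ q → x q ≡ 0ℚ
vertex-rigid {P = P} {v} x (_ , c , δ , valid , c·v≡δ , unique) v+x∈P v-x∈P q =
  p+q≡p⇒q≡0 (v q) (x q) (unique (v +ᵥ x) v+x∈P c·[v+x]≡δ q)
  where
  c·[v+x] : c · (v +ᵥ x) ≡ δ + c · x
  c·[v+x] = trans (·-+ᵥ c v x) (cong (_+ c · x) c·v≡δ)
  c·[v-x] : c · (v +ᵥ ((- 1ℚ) *ᵥ x)) ≡ δ + - 1ℚ * (c · x)
  c·[v-x] = trans (·-+ᵥ c v ((- 1ℚ) *ᵥ x)) (cong₂ _+_ c·v≡δ (·-*ᵥ c (- 1ℚ) x))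
  c·[v+x]≡δ : c · (v +ᵥ x) ≡ δ
  c·[v+x]≡δ = ≤-antisym (valid _ v+x∈P) (subst₂ _≤_
    (solve 2 (λ d y → (d :+ con (- 1ℚ) :* y) :+ y := d) refl δ (c · x))
    (sym c·[v+x])
    (+-monoˡ-≤ (c · x) (subst (_≤ δ) c·[v-x] (valid _ v-x∈P))))

·-shift : ∀ {n} (a x g : Vec℘ n) ε → a · g ≡ 0ℚ → a · (x +ᵥ (ε *ᵥ g)) ≡ a · x
·-shift a x g ε a·g≡0 = begin
  a · (x +ᵥ (ε *ᵥ g))  ≡⟨ ·-+ᵥ a x (ε *ᵥ g) ⟩
  a · x + a · (ε *ᵥ g) ≡⟨ cong (a · x +_) (·-*ᵥ a ε g) ⟩
  a · x + ε * (a · g)  ≡⟨ cong (λ t → a · x + ε * t) a·g≡0 ⟩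
  a · x + ε * 0ℚ       ≡⟨ solve 2 (λ y ε → y :+ ε :* con 0ℚ := y) refl (a · x) ε ⟩
  a · x                ∎
  where open ≡-Reasoning

-- A direction that changes no tight row can be followed by a small `ε` both ways, which
-- `vertex-rigid` forbids unless it is zero. The family `row` lists finitely many inequalities that
-- imply all the others, so only these are tested.
essential-rigid : ∀ {n K} (P : Polyhedron n) (row : Fin K → Polyhedron.J P) → let open Polyhedron P in
  (∀ x → (∀ i → A i · x ≡ b i) → (∀ r → B (row r) · x ≤ d (row r)) → _∈P P x) →
  ∀ {v g} → IsVertex P v → InKer P g → (∀ r → Ternary (B (row r) · g)) →
  (∀ r → B (row r) · g ≢ 0ℚ → B (row r) · v ≢ d (row r)) → ∀ q → g q ≡ 0ℚ
essential-rigid P row feasible {v} {g} vertex@(v∈P , _) Ag≡0 ternary g-slack q =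
  p≢0∧p*q≡0⇒q≡0 ε (g q) (<⇒≢ ε>0 ∘ sym) (vertex-rigid {P = P} {v} (ε *ᵥ g) vertex
    (feasible (v +ᵥ (ε *ᵥ g)) (λ i → trans (·-shift (A i) v g ε (Ag≡0 i)) (proj₁ v∈P i)) forward)
    (feasible (v +ᵥ ((- 1ℚ) *ᵥ (ε *ᵥ g))) equations backward) q)
  where
  open Polyhedron P
  slack : Vec℘ _
  slack r = d (row r) - B (row r) · v
  slack-nonneg : ∀ r → 0ℚ ≤ slack r
  slack-nonneg r = p≤q⇒0≤q-p (proj₂ v∈P (row r))
  gapped = positive-gap slack slack-nonneg
  ε = proj₁ gapped
  ε>0 = proj₁ (proj₂ gapped)
  gap = proj₂ (proj₂ gapped)
  equations : ∀ i → A i · (v +ᵥ ((- 1ℚ) *ᵥ (ε *ᵥ g))) ≡ b i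
  equations i = trans (·-shift (A i) v (ε *ᵥ g) (- 1ℚ)
    (trans (·-*ᵥ (A i) ε g) (trans (cong (ε *_) (Ag≡0 i)) (*-zeroʳ ε)))) (proj₁ v∈P i)
  tight : ∀ r → slack r ≡ 0ℚ → B (row r) · g ≡ 0ℚ
  tight r slack≡0 = decidable-stable (B (row r) · g ≟ 0ℚ) (λ Bg≢0 → g-slack r Bg≢0
    (trans (solve 2 (λ a e → a := e :+ :- (e :+ :- a)) refl (B (row r) · v) (d (row r)))
      (trans (cong (λ t → d (row r) - t) slack≡0) (+-identityʳ (d (row r))))))
  nonneg : ∀ r t → Ternary t → (B (row r) · g ≡ 0ℚ → t ≢ - 1ℚ) → 0ℚ ≤ slack r + ε * t
  nonneg r t t-ternary t≢-1 =
    ternary-shift-nonneg (slack r) t (<⇒≤ ε>0) (gap r) (slack-nonneg r) t-ternary (t≢-1 ∘ tight r)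
  forward : ∀ r → B (row r) · (v +ᵥ (ε *ᵥ g)) ≤ d (row r)
  forward r = 0≤q-p⇒p≤q (subst (0ℚ ≤_)
    (trans (solve 4 (λ a e f h → (f :+ :- a) :+ e :* (:- h) := f :+ :- (a :+ e :* h)) refl
        (B (row r) · v) ε (d (row r)) (B (row r) · g))
      (cong (λ t → d (row r) - t) (sym (trans (·-+ᵥ (B (row r)) v (ε *ᵥ g))
        (cong (B (row r) · v +_) (·-*ᵥ (B (row r)) ε g))))))
    (nonneg r (- (B (row r) · g)) (ternary-neg (ternary r))
      (λ Bg≡0 -Bg≡-1 → contradiction (trans (sym (cong (λ t → - t) Bg≡0)) -Bg≡-1) (λ ()))))
  backward : ∀ r → B (row r) · (v +ᵥ ((- 1ℚ) *ᵥ (ε *ᵥ g))) ≤ d (row r)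
  backward r = 0≤q-p⇒p≤q (subst (0ℚ ≤_)
    (trans (solve 4 (λ a e f h → (f :+ :- a) :+ e :* h := f :+ :- (a :+ con (- 1ℚ) :* (e :* h))) refl
        (B (row r) · v) ε (d (row r)) (B (row r) · g))
      (cong (λ t → d (row r) - t) (sym (trans (·-+ᵥ (B (row r)) v ((- 1ℚ) *ᵥ (ε *ᵥ g)))
        (cong (B (row r) · v +_) (trans (·-*ᵥ (B (row r)) (- 1ℚ) (ε *ᵥ g))
          (cong (- 1ℚ *_) (·-*ᵥ (B (row r)) ε g))))))))
    (nonneg r (B (row r) · g) (ternary r)
      (λ Bg≡0 Bg≡-1 → contradiction (trans (sym Bg≡0) Bg≡-1) (λ ()))))

-- Vertices, circuits and faces of polyhedra in standard form.

-- Polyhedra of the form {x : A x = b, x ≥ 0}, possibly with further redundant inequalities: those do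
-- not affect feasibility but they do affect which vectors are circuits.
record Standard {n} (P : Polyhedron n) : Set where
  open Polyhedron P
  field
    bound    : Fin n → J
    B-bound  : ∀ q → B (bound q) ≡ (- 1ℚ) *ᵥ unit q
    d-bound  : ∀ q → d (bound q) ≡ 0ℚ
    feasible : ∀ x → (∀ i → A i · x ≡ b i) → (∀ q → 0ℚ ≤ x q) → _∈P P x

module StandardForm {n} {P : Polyhedron n} (std : Standard P) where
  open Polyhedron P
  open Standard std

  bound-· : ∀ q x → B (bound q) · x ≡ - x q
  bound-· q x = trans (cong (_· x) (B-bound q)) (-unit-· q x)

  bounds⇒nonneg : ∀ x → (∀ q → B (bound q) · x ≤ d (bound q)) → ∀ q → 0ℚ ≤ x q
  bounds⇒nonneg x Bx≤d q = subst (0ℚ ≤_) (solve 1 (λ a → :- (:- a) := a) refl (x q))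
    (neg-antimono-≤ (subst₂ _≤_ (bound-· q x) (d-bound q) (Bx≤d q)))

  ∈P⇒nonneg : ∀ x → _∈P P x → ∀ q → 0ℚ ≤ x q
  ∈P⇒nonneg x (_ , Bx≤d) = bounds⇒nonneg x (Bx≤d ∘ bound)

  SuppSub⇒support : ∀ {x y} → SuppSub P x y → ∀ q → x q ≢ 0ℚ → y q ≢ 0ℚ
  SuppSub⇒support {x} {y} x⊆y q xq≢0 yq≡0 = x⊆y (bound q)
    (λ Bx≡0 → xq≢0 (-p≡0⇒p≡0 (x q) (trans (sym (bound-· q x)) Bx≡0)))
    (trans (bound-· q y) (cong (λ t → - t) yq≡0))

  shift-feasible : ∀ x g ε → _∈P P x → InKer P g → (∀ q → 0ℚ ≤ x q + ε * g q) →
                   _∈P P (x +ᵥ (ε *ᵥ g))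
  shift-feasible x g ε (Ax≡b , _) Ag≡0 =
    feasible _ (λ i → trans (·-shift (A i) x g ε (Ag≡0 i)) (Ax≡b i))

  -- `essential-rigid` for the sign constraints: a tight row is a zero entry of `v`, and `g` moves
  -- none of these.
  vertex-support-rigid : ∀ {v g} → IsVertex P v → InKer P g → (∀ q → Ternary (g q)) →
                         (∀ q → g q ≢ 0ℚ → v q ≢ 0ℚ) → ∀ q → g q ≡ 0ℚ
  vertex-support-rigid {v} {g} vertex Ag≡0 ternary g⊆v = essential-rigid P bound
    (λ x Ax≡b Bx≤d → feasible x Ax≡b (bounds⇒nonneg x Bx≤d)) {v} {g} vertex Ag≡0
    (λ q → subst Ternary (sym (bound-· q g)) (ternary-neg (ternary q)))
    (λ q Bg≢0 Bv≡d → g⊆v q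
      (λ gq≡0 → Bg≢0 (trans (bound-· q g) (cong (λ t → - t) gq≡0)))
      (-p≡0⇒p≡0 (v q) (trans (sym (bound-· q v)) (trans Bv≡d (d-bound q)))))

  -- Some coordinate has to block the step, i.e. reach 0 while decreasing at rate 1; its starting
  -- value is then the step length `α`, which is therefore an integer. Without such a coordinate the
  -- step could be prolonged by some `ε`, against maximality.
  maximal-step-integer : ∀ {y y′ g α} → _∈P P y → _∈P P y′ → InKer P g → (∀ q → Ternary (g q)) →
    y′ ≈ (y +ᵥ (α *ᵥ g)) → (∀ α′ → α < α′ → ¬ (_∈P P (y +ᵥ (α′ *ᵥ g)))) →
    IntegerPoint y → IntegerPoint y′
  maximal-step-integer {y} {y′} {g} {α} y∈P y′∈P Ag≡0 ternary y′≈ maximal y-integer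
    with any? (λ q → (y′ q ≟ 0ℚ) ×-dec (g q ≟ - 1ℚ))
  ... | yes (p , y′p≡0 , gp≡-1) = λ q → subst IsIntegerℚ (sym (y′≈ q))
    (+-integer (y q) (α * g q) (y-integer q)
      (*-integer α (g q) (subst IsIntegerℚ (sym α≡yp) (y-integer p)) (ternary-integer (ternary q))))
    where
    open ≡-Reasoning
    α≡yp : α ≡ y p
    α≡yp = begin
      α                            ≡⟨ solve 2 (λ a e → a := e :+ :- (e :+ a :* con (- 1ℚ))) refl α (y p) ⟩
      y p - (y p + α * - 1ℚ)       ≡⟨ cong (λ t → y p - (y p + α * t)) (sym gp≡-1) ⟩
      y p - (y p + α * g p)        ≡⟨ cong (λ t → y p - t) (trans (sym (y′≈ p)) y′p≡0) ⟩
      y p - 0ℚ                     ≡⟨ +-identityʳ (y p) ⟩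
      y p                          ∎
  ... | no loose = contradiction
    (shift-feasible y g (α + ε) y∈P Ag≡0 (λ q → subst (0ℚ ≤_) (further q) (still-nonneg q)))
    (maximal (α + ε) (subst (_< α + ε) (+-identityʳ α) (+-monoʳ-< α ε>0)))
    where
    gapped = positive-gap y′ (∈P⇒nonneg y′ y′∈P)
    ε = proj₁ gapped
    ε>0 = proj₁ (proj₂ gapped)
    gap = proj₂ (proj₂ gapped)
    further : ∀ q → y′ q + ε * g q ≡ y q + (α + ε) * g q
    further q = trans (cong (_+ ε * g q) (y′≈ q))
      (solve 4 (λ a e c b → (a :+ e :* b) :+ c :* b := a :+ (e :+ c) :* b) refl (y q) α ε (g q))
    still-nonneg : ∀ q → 0ℚ ≤ y′ q + ε * g q
    still-nonneg q = ternary-shift-nonneg (y′ q) (g q) (<⇒≤ ε>0) (gap q) (∈P⇒nonneg y′ y′∈P q)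
      (ternary q) (λ y′q≡0 gq≡-1 → loose (q , y′q≡0 , gq≡-1))

  -- Elimination at `q`: the combination `g q * x - x q * g` lies in the kernel, has support within
  -- that of `g` and vanishes at `q`. Were it nonzero, minimality of `g` would give `g q = 0`. The
  -- conclusion is proportionality, written without division.
  circuit-pivot : ∀ {g} x → IsCircuit P g → InKer P x → SuppSub P x g → ∀ q → g q ≢ 0ℚ →
                  ∀ j → g q * x j ≡ x q * g j
  circuit-pivot {g} x (Ag≡0 , _ , _ , minimal) Ax≡0 x⊆g q gq≢0 j with ((g q *ᵥ x) +ᵥ ((- x q) *ᵥ g)) j ≟ 0ℚ
  ... | yes wj≡0 = begin
    g q * x j
      ≡⟨ solve 4 (λ a b c d → a :* b := (a :* b :+ (:- c) :* d) :+ c :* d) refl (g q) (x j) (x q) (g j) ⟩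
    (g q * x j + - x q * g j) + x q * g j
      ≡⟨ cong (_+ x q * g j) wj≡0 ⟩
    0ℚ + x q * g j
      ≡⟨ +-identityˡ (x q * g j) ⟩
    x q * g j ∎
    where open ≡-Reasoning
  ... | no wj≢0 = contradiction
    (solve 2 (λ a b → a :* b :+ (:- b) :* a := con 0ℚ) refl (g q) (x q))
    (SuppSub⇒support {g} {w} (minimal w
      (λ i → combination (A i) (Ax≡0 i) (Ag≡0 i)) (j , wj≢0)
      (λ r Bw≢0 Bg≡0 → Bw≢0
        (combination (B r) (decidable-stable (B r · x ≟ 0ℚ) (λ Bx≢0 → x⊆g r Bx≢0 Bg≡0)) Bg≡0)))
      q gq≢0)
    where
    w : Vec℘ n
    w = (g q *ᵥ x) +ᵥ ((- x q) *ᵥ g)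
    combination : ∀ a → a · x ≡ 0ℚ → a · g ≡ 0ℚ → a · w ≡ 0ℚ
    combination a a·x≡0 a·g≡0 = trans (·-shift a (g q *ᵥ x) g (- x q) a·g≡0)
      (trans (·-*ᵥ a (g q) x) (trans (cong (g q *_) a·x≡0) (*-zeroʳ (g q))))

  -- By `circuit-pivot`, `g = t * h` with `t = h q * g q`, since `h q` squares to 1. The integer `t`
  -- divides every entry of `g`, so coprimality leaves only `t = 1` or `t = -1`.
  circuit-ternary : ∀ {g h} → IsCircuit P g → InKer P h → (∀ q → Ternary (h q)) →
                    (∃ λ q → h q ≢ 0ℚ) → SuppSub P h g → ∀ j → Ternary (g j)
  circuit-ternary {g} {h} circuit@(_ , _ , (g-integer , coprime) , _) Ah≡0 ternary (q , hq≢0) h⊆g j =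
    subst Ternary (sym (g≡th j)) (ternary-* t-ternary (ternary j))
    where
    open ≡-Reasoning
    t : ℚ
    t = h q * g q
    g≡th : ∀ j → g j ≡ t * h j
    g≡th j = begin
      g j                ≡⟨ sym (*-identityˡ (g j)) ⟩
      1ℚ * g j           ≡⟨ cong (_* g j) (sym (ternary-square (ternary q) hq≢0)) ⟩
      (h q * h q) * g j  ≡⟨ *-assoc (h q) (h q) (g j) ⟩
      h q * (h q * g j)  ≡⟨ cong (h q *_)
        (sym (circuit-pivot h circuit Ah≡0 h⊆g q (SuppSub⇒support {h} {g} h⊆g q hq≢0) j)) ⟩
      h q * (g q * h j)  ≡⟨ sym (*-assoc (h q) (g q) (h j)) ⟩
      t * h j            ∎
    ∣t∣∣ : ∀ s → Ternary s → ℤ.∣ ↥ t ∣ ∣ ℤ.∣ ↥ (t * s) ∣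
    ∣t∣∣ s (inj₁ refl) = subst (λ r → ℤ.∣ ↥ t ∣ ∣ ℤ.∣ ↥ r ∣) (sym (*-zeroʳ t)) (_ ∣0)
    ∣t∣∣ s (inj₂ (inj₁ refl)) = subst (λ r → ℤ.∣ ↥ t ∣ ∣ ℤ.∣ ↥ r ∣) (sym (*-identityʳ t)) ∣-refl
    ∣t∣∣ s (inj₂ (inj₂ refl)) = ∣-reflexive (sym (begin
      ℤ.∣ ↥ (t * - 1ℚ) ∣  ≡⟨ cong (λ r → ℤ.∣ ↥ r ∣) (solve 1 (λ t → t :* con (- 1ℚ) := :- t) refl t) ⟩
      ℤ.∣ ↥ (- t) ∣       ≡⟨ cong ℤ.∣_∣ (↥-neg t) ⟩
      ℤ.∣ ℤ.- (↥ t) ∣     ≡⟨ ℤ.∣-i∣≡∣i∣ (↥ t) ⟩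
      ℤ.∣ ↥ t ∣           ∎))
    t-ternary : Ternary t
    t-ternary = ∣↥q∣≡1⇒ternary t (*-integer (h q) (g q) (ternary-integer (ternary q)) (g-integer q))
      (coprime ℤ.∣ ↥ t ∣ (λ j → subst (λ r → ℤ.∣ ↥ t ∣ ∣ ℤ.∣ ↥ r ∣) (sym (g≡th j)) (∣t∣∣ (h j) (ternary j))))

  integral-walks : GCW P → (∀ g → IsCircuit P g → ∀ q → Ternary (g q)) → ICW P
  integral-walks gcw ternary = gcw , λ v₁ v₂ v₁-vertex _ W → <-weakInduction
    (λ i → IntegerPoint (CircuitWalk.y W i))
    (λ q → subst IsIntegerℚ (sym (CircuitWalk.start W q)) (gcw v₁ v₁-vertex q))
    (λ i y-integer → let g , α , circuit , _ , y′≈ , maximal = CircuitWalk.step W i in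
      maximal-step-integer (CircuitWalk.inP W (inject₁ i)) (CircuitWalk.inP W (suc i))
        (proj₁ circuit) (ternary g circuit) y′≈ maximal y-integer)

  -- face u = −Σ {x_q : u_q = 0} exposes the face of points of P vanishing wherever u does.
  zeros : Vec℘ n → Vec℘ n
  zeros u q = if does (u q ≟ 0ℚ) then 1ℚ else 0ℚ

  zeros-nonneg : ∀ u x → _∈P P x → ∀ q → 0ℚ ≤ zeros u q * x q
  zeros-nonneg u x x∈P q with does (u q ≟ 0ℚ)
  ... | true  = subst (0ℚ ≤_) (sym (*-identityˡ (x q))) (∈P⇒nonneg x x∈P q)
  ... | false = ≤-reflexive (sym (*-zeroˡ (x q)))

  face : Vec℘ n → Vec℘ n
  face u = (- 1ℚ) *ᵥ zeros u

  face-· : ∀ u x → face u · x ≡ - (zeros u · x)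
  face-· u x = trans (*ᵥ-· (- 1ℚ) (zeros u) x)
    (solve 1 (λ a → con (- 1ℚ) :* a := :- a) refl (zeros u · x))

  face-valid : ∀ u → Valid P (face u) 0ℚ
  face-valid u x x∈P = subst (_≤ 0ℚ) (sym (face-· u x))
    (neg-antimono-≤ (∑-nonneg (zeros-nonneg u x x∈P)))

  face-tight : ∀ u x → (∀ q → u q ≡ 0ℚ → x q ≡ 0ℚ) → face u · x ≡ 0ℚ
  face-tight u x x⊆u = trans (face-· u x) (cong (λ t → - t) (∑-zero term≡0))
    where
    term≡0 : ∀ q → zeros u q * x q ≡ 0ℚ
    term≡0 q with u q ≟ 0ℚ
    ... | yes uq≡0 = trans (cong (1ℚ *_) (x⊆u q uq≡0)) (*-zeroʳ 1ℚ)
    ... | no _     = *-zeroˡ (x q)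

  face-zeros : ∀ u x → _∈P P x → face u · x ≡ 0ℚ → ∀ q → u q ≡ 0ℚ → x q ≡ 0ℚ
  face-zeros u x x∈P tight q uq≡0 with zeros-nonneg u x x∈P | term≤∑ (zeros-nonneg u x x∈P) q
  ... | nonneg | term≤ with u q ≟ 0ℚ
  ... | no uq≢0 = contradiction uq≡0 uq≢0
  ... | yes _   = ≤-antisym
    (subst₂ _≤_ (*-identityˡ (x q)) (-p≡0⇒p≡0 (zeros u · x) (trans (sym (face-· u x)) tight)) term≤)
    (∈P⇒nonneg x x∈P q)

  -- `face v` is at most 0 on `P` and attains 0 exactly at the points that vanish wherever `v` does,
  -- so it exposes `v` alone.
  support-vertex : ∀ v → _∈P P v →
    (∀ z → _∈P P z → (∀ q → v q ≡ 0ℚ → z q ≡ 0ℚ) → z ≈ v) → IsVertex P v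
  support-vertex v v∈P unique = v∈P , face v , 0ℚ , face-valid v ,
    face-tight v v (λ _ vq≡0 → vq≡0) ,
    λ z z∈P tight → unique z z∈P (face-zeros v z z∈P tight)

-- Polyhedra with row-sum and column-sum equations.

-- The common ground of transportation and fixed-size partition polytopes. The field `support` says
-- that the inequality rows see no more than which coordinates vanish.
record Grid m n (P : Polyhedron (m ℕ.* n)) : Set where
  open Polyhedron P
  field
    standard  : Standard P
    row       : Fin m → I
    column    : Fin n → I
    A-row     : ∀ i → A (row i) ≡ rowSel m n i
    A-column  : ∀ j → A (column j) ≡ colSel m n j
    kernel    : ∀ x → (∀ i → rowSel m n i · x ≡ 0ℚ) → (∀ j → colSel m n j · x ≡ 0ℚ) → InKer P x
    b-integer : ∀ i → IsIntegerℚ (b i)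
    support   : ∀ x y → (∀ q → x q ≢ 0ℚ → y q ≢ 0ℚ) → SuppSub P x y

rowOf : ∀ m n → Fin (m ℕ.* n) → Fin m
rowOf m n q = proj₁ (remQuot {m} n q)

columnOf : ∀ m n → Fin (m ℕ.* n) → Fin n
columnOf m n q = proj₂ (remQuot {m} n q)

cell-injective : ∀ m n {p q} → rowOf m n p ≡ rowOf m n q → columnOf m n p ≡ columnOf m n q → p ≡ q
cell-injective m n {p} {q} r≡ c≡ = trans (sym (Fin.combine-remQuot {m} n p))
  (trans (cong₂ Fin.combine r≡ c≡) (Fin.combine-remQuot {m} n q))

module GridForm {m n} {P : Polyhedron (m ℕ.* n)} (grid : Grid m n P) where
  open Polyhedron P
  open Grid grid
  open StandardForm standard

  kernel-cycle : ∀ {Z} → Subgroup Z → ∀ x → (∀ i → Z (A i · x)) → (∃ λ q → ¬ Z (x q)) →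
    ∃ λ g → InKer P g × (∀ q → Ternary (g q)) × (∃ λ q → g q ≢ 0ℚ) × (∀ q → g q ≢ 0ℚ → ¬ Z (x q))
  kernel-cycle {Z} Z-subgroup x sums∈ start =
    let g , rows , columns , ternary , nonzero , g⊆ =
          AlternatingCycle.alternating-cycle (rowOf m n) (columnOf m n) (λ q → ¬ Z (x q))
            (cell-injective m n)
            (another Z-subgroup (rowOf m n) x (λ i → subst Z (cong (_· x) (A-row i)) (sums∈ (row i))))
            (another Z-subgroup (columnOf m n) x
              (λ j → subst Z (cong (_· x) (A-column j)) (sums∈ (column j))))
            start
    in g , kernel g rows columns , ternary , nonzero , g⊆

  -- With `Z` = ℤ the cycle runs through fractional entries only. These are nonzero, so the vertex
  -- could move along the cycle in both directions.
  vertices-integer : GCW P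
  vertices-integer v vertex q = decidable-stable (IsInteger? (v q)) (λ vq∉ →
    let g , Ag≡0 , ternary , (p , gp≢0) , g⊆ = kernel-cycle integers v
          (λ i → subst IsIntegerℚ (sym (proj₁ (proj₁ vertex) i)) (b-integer i)) (q , vq∉)
    in gp≢0 (vertex-support-rigid {v} {g} vertex Ag≡0 ternary
      (λ r gr≢0 vr≡0 → g⊆ r gr≢0 (subst IsIntegerℚ (sym vr≡0) refl)) p))

  -- With `Z` = {0} the cycle lies inside the support of `g`, and `circuit-ternary` compares the
  -- two.
  circuits-ternary : ∀ g → IsCircuit P g → ∀ q → Ternary (g q)
  circuits-ternary g circuit@(Ag≡0 , nonzero , _) =
    let h , Ah≡0 , ternary , h-nonzero , h⊆g = kernel-cycle zeroSubgroup g Ag≡0 nonzero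
    in circuit-ternary {g} {h} circuit Ah≡0 ternary h-nonzero (support h g h⊆g)

  icw : ICW P
  icw = integral-walks vertices-integer circuits-ternary

-- Polytopes with unit column sums: integer points are vertices, circuit steps are edges.

01-difference : ∀ {p q} → p ≡ 0ℚ ⊎ p ≡ 1ℚ → q ≡ 0ℚ ⊎ q ≡ 1ℚ → Ternary (q - p)
01-difference (inj₁ refl) (inj₁ refl) = inj₁ refl
01-difference (inj₁ refl) (inj₂ refl) = inj₂ (inj₁ refl)
01-difference (inj₂ refl) (inj₁ refl) = inj₂ (inj₂ refl)
01-difference (inj₂ refl) (inj₂ refl) = inj₁ refl

1-q≤1 : ∀ {q} → 0ℚ ≤ q → 1ℚ - q ≤ 1ℚ
1-q≤1 {q} q≥0 = 0≤q-p⇒p≤q (subst (0ℚ ≤_)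
  (solve 1 (λ a → a := con 1ℚ :+ :- (con 1ℚ :+ :- a)) refl q) q≥0)

-- For `p` and `q` the two ends of [0,1], the product is the relative position of `z` on the way
-- from `p` to `q`.
01-parameter : ∀ {p q z} → p ≡ 0ℚ ⊎ p ≡ 1ℚ → q ≡ 0ℚ ⊎ q ≡ 1ℚ → q - p ≢ 0ℚ → 0ℚ ≤ z → z ≤ 1ℚ →
               0ℚ ≤ (q - p) * (z + - 1ℚ * p) × (q - p) * (z + - 1ℚ * p) ≤ 1ℚ
01-parameter (inj₁ refl) (inj₁ refl) q-p≢0 z≥0 z≤1 = contradiction refl q-p≢0
01-parameter (inj₂ refl) (inj₂ refl) q-p≢0 z≥0 z≤1 = contradiction refl q-p≢0
01-parameter {z = z} (inj₁ refl) (inj₂ refl) q-p≢0 z≥0 z≤1 = subst (λ t → 0ℚ ≤ t × t ≤ 1ℚ)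
  (solve 1 (λ a → a := con 1ℚ :* (a :+ con 0ℚ)) refl z) (z≥0 , z≤1)
01-parameter {z = z} (inj₂ refl) (inj₁ refl) q-p≢0 z≥0 z≤1 = subst (λ t → 0ℚ ≤ t × t ≤ 1ℚ)
  (solve 1 (λ a → con 1ℚ :+ :- a := con (- 1ℚ) :* (a :+ con (- 1ℚ))) refl z)
  (p≤q⇒0≤q-p z≤1 , 1-q≤1 z≥0)

-- Only the column sums are prescribed, so that fixed-size and bounded-size partition polytopes both
-- qualify.
module PartitionForm {N n} {P : Polyhedron N} (std : Standard P) (c : Fin N → Fin n)
  (column-sum : ∀ x → _∈P P x → ∀ j → sel c j · x ≡ 1ℚ) where
  open Polyhedron P
  open StandardForm std

  module _ {x : Vec℘ N} (x∈P : _∈P P x) where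
    entry≤1 : ∀ q → x q ≤ 1ℚ
    entry≤1 q = subst (x q ≤_) (column-sum x x∈P (c q)) (entry≤class-sum c (∈P⇒nonneg x x∈P) q)

    column-rest-zero : ∀ {p q} → x q ≡ 1ℚ → p ≢ q → c p ≡ c q → x p ≡ 0ℚ
    column-rest-zero {p} {q} xq≡1 p≢q cp≡cq = ≤-antisym
      (subst₂ _≤_
        (trans (cong₂ (λ s t → (s + t) - 1ℚ) (own-term c x cp≡cq) (trans (own-term c x refl) xq≡1))
          (solve 1 (λ a → (a :+ con 1ℚ) :+ con (- 1ℚ) := a) refl (x p)))
        (cong (_- 1ℚ) (column-sum x x∈P (c q)))
        (+-monoˡ-≤ (- 1ℚ) (two-terms≤∑ (sel-nonneg c (c q) (∈P⇒nonneg x x∈P)) p q p≢q)))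
      (∈P⇒nonneg x x∈P p)

    column-single : ∀ q → (∀ p → p ≢ q → c p ≡ c q → x p ≡ 0ℚ) → x q ≡ 1ℚ
    column-single q rest≡0 = trans (sym (own-term c x refl))
      (trans (sym (∑-single q others)) (column-sum x x∈P (c q)))
      where
      others : ∀ p → p ≢ q → sel c (c q) p * x p ≡ 0ℚ
      others p p≢q with c p Fin.≟ c q
      ... | yes cp≡cq = trans (cong (1ℚ *_) (rest≡0 p p≢q cp≡cq)) (*-zeroʳ 1ℚ)
      ... | no _      = *-zeroˡ (x p)

    entry-01 : IntegerPoint x → ∀ q → x q ≡ 0ℚ ⊎ x q ≡ 1ℚ
    entry-01 x-integer q = integer-0≤q≤1 (x q) (x-integer q) (∈P⇒nonneg x x∈P q) (entry≤1 q)

  -- An entry 1 of `v` forces zeros in the rest of its column. A point `z` vanishing where `v` does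
  -- inherits them, and its column sum then puts a 1 in the same cell.
  integer-vertex : ∀ v → _∈P P v → IntegerPoint v → IsVertex P v
  integer-vertex v v∈P v-integer = support-vertex v v∈P unique
    where
    unique : ∀ z → _∈P P z → (∀ q → v q ≡ 0ℚ → z q ≡ 0ℚ) → z ≈ v
    unique z z∈P z⊆v q = [ (λ vq≡0 → trans (z⊆v q vq≡0) (sym vq≡0)) , at-one ]′
      (entry-01 v∈P v-integer q)
      where
      at-one : v q ≡ 1ℚ → z q ≡ v q
      at-one vq≡1 = trans
        (column-single z∈P q (λ p p≢q cp≡cq → z⊆v p (column-rest-zero v∈P vq≡1 p≢q cp≡cq)))
        (sym vq≡1)

  vertex-walks : ICW P → VCW P
  vertex-walks (gcw , integral) = gcw , λ v₁ v₂ v₁-vertex v₂-vertex W i →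
    integer-vertex _ (CircuitWalk.inP W i) (integral v₁ v₂ v₁-vertex v₂-vertex W i)

  module _ (support : ∀ x y → (∀ q → x q ≢ 0ℚ → y q ≢ 0ℚ) → SuppSub P x y) where

    step-edge : ∀ {y y′} → _∈P P y → _∈P P y′ → IntegerPoint y → IntegerPoint y′ →
                CircuitStep P y y′ → IsEdge P y y′
    step-edge {y} {y′} y∈P y′∈P y-integer y′-integer
      (g , α , circuit@(Ag≡0 , (p , gp≢0) , _) , α>0 , y′≈ , _) =
      integer-vertex y y∈P y-integer , integer-vertex y′ y′∈P y′-integer , y≉y′ ,
      face u , 0ℚ , face-valid u ,
      face-tight u y (λ q → proj₁ ∘ summands-zero q) , face-tight u y′ (λ q → proj₂ ∘ summands-zero q) ,
      segment
      where
      open ≡-Reasoning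

      u : Vec℘ N
      u = y +ᵥ y′

      summands-zero : ∀ q → y q + y′ q ≡ 0ℚ → y q ≡ 0ℚ × y′ q ≡ 0ℚ
      summands-zero q sum≡0 =
        ≤-antisym (subst (y q ≤_) sum≡0 (p≤p+q (y q) (∈P⇒nonneg y′ y′∈P q))) (∈P⇒nonneg y y∈P q) ,
        ≤-antisym (subst (y′ q ≤_) sum≡0 (q≤p+q (y′ q) (∈P⇒nonneg y y∈P q))) (∈P⇒nonneg y′ y′∈P q)

      e : Vec℘ N
      e q = y′ q - y q

      e≡αg : ∀ q → e q ≡ α * g q
      e≡αg q = trans (cong (_- y q) (y′≈ q))
        (solve 2 (λ a b → (a :+ b) :+ :- a := b) refl (y q) (α * g q))

      ep≢0 : e p ≢ 0ℚ
      ep≢0 ep≡0 = gp≢0 (p≢0∧p*q≡0⇒q≡0 α (g p) (<⇒≢ α>0 ∘ sym) (trans (sym (e≡αg p)) ep≡0))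

      y≉y′ : ¬ (y ≈ y′)
      y≉y′ y≈y′ = ep≢0 (trans (cong (λ t → y′ p - t) (y≈y′ p)) (+-inverseʳ (y′ p)))

      ep-ternary : Ternary (e p)
      ep-ternary = 01-difference (entry-01 y∈P y-integer p) (entry-01 y′∈P y′-integer p)

      segment : ∀ z → _∈P P z → face u · z ≡ 0ℚ →
        ∃ λ t → 0ℚ ≤ t × t ≤ 1ℚ × z ≈ ((t *ᵥ y) +ᵥ ((1ℚ - t) *ᵥ y′))
      -- `s` measures the progress from `y` towards `y′`, whereas `IsEdge` asks for the weight of
      -- `y`; hence `1ℚ - s`.
      segment z z∈P tight = 1ℚ - s , p≤q⇒0≤q-p (proj₂ s-range) , 1-q≤1 (proj₁ s-range) , z≈
        where
        x : Vec℘ N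
        x = z +ᵥ ((- 1ℚ) *ᵥ y)

        -- `e p` is 1 or -1, so this product is the quotient of `x p` by `e p`.
        s : ℚ
        s = e p * x p

        x-zero : ∀ q → z q ≡ y q → x q ≡ 0ℚ
        x-zero q zq≡yq = trans (cong (_+ - 1ℚ * y q) zq≡yq)
          (solve 1 (λ a → a :+ con (- 1ℚ) :* a := con 0ℚ) refl (y q))

        z-zero : ∀ q → y q ≡ 0ℚ → y′ q ≡ 0ℚ → z q ≡ 0ℚ
        z-zero q yq≡0 y′q≡0 = face-zeros u z z∈P tight q (cong₂ _+_ yq≡0 y′q≡0)

        unchanged : ∀ q → g q ≡ 0ℚ → y′ q ≡ y q
        unchanged q gq≡0 = trans (y′≈ q) (trans (cong (λ t → y q + α * t) gq≡0)
          (solve 2 (λ a b → a :+ b :* con 0ℚ := a) refl (y q) α))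

        -- Where `g` vanishes, `y` and `y′` agree. A common 0 is inherited by `z` through the face;
        -- a common 1 empties the rest of its column in `y` and `y′`, hence in `z`, and leaves the
        -- whole column sum in this cell.
        z-unchanged : ∀ q → g q ≡ 0ℚ → z q ≡ y q
        z-unchanged q gq≡0 = [ at-zero , at-one ]′ (entry-01 y∈P y-integer q)
          where
          at-zero : y q ≡ 0ℚ → z q ≡ y q
          at-zero yq≡0 = trans (z-zero q yq≡0 (trans (unchanged q gq≡0) yq≡0)) (sym yq≡0)
          at-one : y q ≡ 1ℚ → z q ≡ y q
          at-one yq≡1 = trans
            (column-single z∈P q (λ r r≢q cr≡cq → z-zero r
              (column-rest-zero y∈P yq≡1 r≢q cr≡cq)
              (column-rest-zero y′∈P (trans (unchanged q gq≡0) yq≡1) r≢q cr≡cq)))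
            (sym yq≡1)

        Ax≡0 : InKer P x
        Ax≡0 i = begin
          A i · x                        ≡⟨ ·-+ᵥ (A i) z ((- 1ℚ) *ᵥ y) ⟩
          A i · z + A i · ((- 1ℚ) *ᵥ y)  ≡⟨ cong (A i · z +_) (·-*ᵥ (A i) (- 1ℚ) y) ⟩
          A i · z + - 1ℚ * (A i · y)     ≡⟨ cong₂ (λ t w → t + - 1ℚ * w) (proj₁ z∈P i) (proj₁ y∈P i) ⟩
          b i + - 1ℚ * b i               ≡⟨ solve 1 (λ a → a :+ con (- 1ℚ) :* a := con 0ℚ) refl (b i) ⟩
          0ℚ                             ∎

        pivot : ∀ j → g p * x j ≡ x p * g j
        pivot = circuit-pivot {g} x circuit Ax≡0
          (support x g (λ q xq≢0 gq≡0 → xq≢0 (x-zero q (z-unchanged q gq≡0)))) p gp≢0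

        x≡se : ∀ j → x j ≡ s * e j
        x≡se j = begin
          x j                      ≡⟨ sym (*-identityˡ (x j)) ⟩
          1ℚ * x j                 ≡⟨ cong (_* x j) (sym (ternary-square ep-ternary ep≢0)) ⟩
          (e p * e p) * x j        ≡⟨ cong (λ t → (e p * t) * x j) (e≡αg p) ⟩
          (e p * (α * g p)) * x j  ≡⟨ solve 4 (λ a b c d → (a :* (b :* c)) :* d := (a :* b) :* (c :* d))
                                        refl (e p) α (g p) (x j) ⟩
          (e p * α) * (g p * x j)  ≡⟨ cong ((e p * α) *_) (pivot j) ⟩
          (e p * α) * (x p * g j)  ≡⟨ solve 4 (λ a b c d → (a :* b) :* (c :* d) := (a :* c) :* (b :* d))
                                        refl (e p) α (x p) (g j) ⟩
          s * (α * g j)            ≡⟨ cong (s *_) (sym (e≡αg j)) ⟩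
          s * e j                  ∎

        s-range : 0ℚ ≤ s × s ≤ 1ℚ
        s-range = 01-parameter (entry-01 y∈P y-integer p) (entry-01 y′∈P y′-integer p) ep≢0
          (∈P⇒nonneg z z∈P p) (entry≤1 z∈P p)

        z≈ : z ≈ (((1ℚ - s) *ᵥ y) +ᵥ ((1ℚ - (1ℚ - s)) *ᵥ y′))
        z≈ j = begin
          z j
            ≡⟨ solve 2 (λ a b → a := b :+ (a :+ con (- 1ℚ) :* b)) refl (z j) (y j) ⟩
          y j + x j
            ≡⟨ cong (y j +_) (x≡se j) ⟩
          y j + s * (y′ j - y j)
            ≡⟨ solve 3 (λ a b s → b :+ s :* (a :+ :- b) := (con 1ℚ :+ :- s) :* b
                 :+ (con 1ℚ :+ :- (con 1ℚ :+ :- s)) :* a) refl (y′ j) (y j) s ⟩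
          (1ℚ - s) * y j + (1ℚ - (1ℚ - s)) * y′ j ∎

    edge-walks : ICW P → ECW P
    edge-walks icw@(gcw , integral) = gcw , λ v₁ v₂ v₁-vertex v₂-vertex W →
      proj₂ (vertex-walks icw) v₁ v₂ v₁-vertex v₂-vertex W ,
      λ i → step-edge (CircuitWalk.inP W (inject₁ i)) (CircuitWalk.inP W (suc i))
        (integral v₁ v₂ v₁-vertex v₂-vertex W (inject₁ i))
        (integral v₁ v₂ v₁-vertex v₂-vertex W (suc i))
        (CircuitWalk.step W i)

-- Transportation and fixed-size partition polytopes as grids; statement (d).

nonneg⇒-unit-row : ∀ {n} {x : Vec℘ n} → (∀ q → 0ℚ ≤ x q) → ∀ q → ((- 1ℚ) *ᵥ unit q) · x ≤ 0ℚ
nonneg⇒-unit-row {x = x} x≥0 q = subst (_≤ 0ℚ) (sym (-unit-· q x)) (neg-antimono-≤ (x≥0 q))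

-unit-row-support : ∀ {n} (x y : Vec℘ n) → (∀ q → x q ≢ 0ℚ → y q ≢ 0ℚ) →
  ∀ q → ((- 1ℚ) *ᵥ unit q) · x ≢ 0ℚ → ((- 1ℚ) *ᵥ unit q) · y ≢ 0ℚ
-unit-row-support x y x⊆y q x-row≢0 y-row≡0 = x⊆y q
  (λ xq≡0 → x-row≢0 (trans (-unit-· q x) (cong (λ t → - t) xq≡0)))
  (-p≡0⇒p≡0 (y q) (trans (sym (-unit-· q y)) y-row≡0))

transportation-grid : ∀ m n u v → Grid m n (TransportationPolytope m n u v)
transportation-grid m n u v = record
  { standard  = record
    { bound    = λ q → q
    ; B-bound  = λ _ → refl
    ; d-bound  = λ _ → refl
    ; feasible = λ x Ax≡b x≥0 → Ax≡b , nonneg⇒-unit-row x≥0 }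
  ; row       = inj₁
  ; column    = inj₂
  ; A-row     = λ _ → refl
  ; A-column  = λ _ → refl
  ; kernel    = λ { x rows columns (inj₁ i) → rows i ; x rows columns (inj₂ j) → columns j }
  ; b-integer = λ { (inj₁ i) → /1-integer (ℤ.+ u i) ; (inj₂ j) → /1-integer (ℤ.+ v j) }
  ; support   = -unit-row-support }

fixed-partition-grid : ∀ k n κ → Grid k n (FixedPartitionPolytope k n κ)
fixed-partition-grid k n κ = record
  { standard  = record
    { bound    = λ q → q
    ; B-bound  = λ _ → refl
    ; d-bound  = λ _ → refl
    ; feasible = λ x Ax≡b x≥0 → Ax≡b , nonneg⇒-unit-row x≥0 }
  ; row       = inj₁
  ; column    = inj₂
  ; A-row     = λ _ → refl
  ; A-column  = λ _ → refl
  ; kernel    = λ { x rows columns (inj₁ i) → rows i ; x rows columns (inj₂ j) → columns j }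
  ; b-integer = λ { (inj₁ i) → /1-integer (ℤ.+ κ i) ; (inj₂ j) → refl }
  ; support   = -unit-row-support }

fixed-partition-ECW : ∀ k n κ → ECW (FixedPartitionPolytope k n κ)
fixed-partition-ECW k n κ = PartitionForm.edge-walks (Grid.standard grid) (columnOf k n)
  (λ x x∈P j → proj₁ x∈P (inj₂ j)) (Grid.support grid) (GridForm.icw grid)
  where grid = fixed-partition-grid k n κ

-- Closed circuit walks of length two, for the counterexamples.

SuppSub-multiple : ∀ {n} (P : Polyhedron n) s {x g} → s ≢ 0ℚ → x ≈ (s *ᵥ g) → SuppSub P g x
SuppSub-multiple P s {x} {g} s≢0 x≈sg r Bg≢0 Bx≡0 =
  Bg≢0 (p≢0∧p*q≡0⇒q≡0 s (B r · g) s≢0 (trans (sym (·-*ᵥ (B r) s g)) (trans (sym (·-congʳ (B r) x≈sg)) Bx≡0)))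
  where open Polyhedron P

-- If only multiples of `g` have support within that of `g`, the support is minimal, as nonzero
-- multiples have the same support. One entry of absolute value 1 settles coprimality.
spanning-circuit : ∀ {n} (P : Polyhedron n) {g} → InKer P g → IntegerPoint g →
  (∃ λ q → ℤ.∣ ↥ (g q) ∣ ≡ 1) → (∀ x → InKer P x → SuppSub P x g → ∃ λ s → x ≈ (s *ᵥ g)) →
  IsCircuit P g
spanning-circuit P {g} Ag≡0 g-integer (q , ∣gq∣≡1) spans =
  Ag≡0 , (q , λ gq≡0 → contradiction (trans (sym (cong (λ t → ℤ.∣ ↥ t ∣) gq≡0)) ∣gq∣≡1) (λ ())) ,
  (g-integer , λ k k∣ → ∣1⇒≡1 (subst (k ∣_) ∣gq∣≡1 (k∣ q))) ,
  λ x Ax≡0 (j , xj≢0) x⊆g → let s , x≈sg = spans x Ax≡0 x⊆g in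
    SuppSub-multiple P s
      (λ s≡0 → xj≢0 (trans (x≈sg j) (trans (cong (_* g j) s≡0) (*-zeroˡ (g j))))) x≈sg

-- Row `r` is tight at `y′` and strictly increases along `g`, so every longer step violates it.
tight-row-maximal : ∀ {n} (P : Polyhedron n) {y y′ g α} r → let open Polyhedron P in
  y′ ≈ (y +ᵥ (α *ᵥ g)) → B r · y′ ≡ d r → 0ℚ < B r · g →
  ∀ α′ → α < α′ → ¬ (_∈P P (y +ᵥ (α′ *ᵥ g)))
tight-row-maximal P {y} {y′} {g} {α} r y′≈ tight g-leaves α′ α<α′ (_ , feasible) =
  <-irrefl refl (<-≤-trans beyond (feasible r))
  where
  open Polyhedron P
  open ≤-Reasoning
  instance positive-leave = positive g-leaves
  beyond : d r < B r · (y +ᵥ (α′ *ᵥ g))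
  beyond = begin-strict
    d r                            ≡⟨ sym tight ⟩
    B r · y′                       ≡⟨ ·-congʳ (B r) y′≈ ⟩
    B r · (y +ᵥ (α *ᵥ g))          ≡⟨ ·-+ᵥ (B r) y (α *ᵥ g) ⟩
    B r · y + B r · (α *ᵥ g)       ≡⟨ cong (B r · y +_) (·-*ᵥ (B r) α g) ⟩
    B r · y + α * (B r · g)        <⟨ +-monoʳ-< (B r · y) (*-monoˡ-<-pos (B r · g) α<α′) ⟩
    B r · y + α′ * (B r · g)       ≡⟨ cong (B r · y +_) (sym (·-*ᵥ (B r) α′ g)) ⟩
    B r · y + B r · (α′ *ᵥ g)      ≡⟨ sym (·-+ᵥ (B r) y (α′ *ᵥ g)) ⟩
    B r · (y +ᵥ (α′ *ᵥ g))         ∎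

-- Walks have to end at vertices while `w` may fail to be one, so the walk returns to `v` along the
-- negated circuit. Row `r` blocks the way out at `w`, row `r′` the way back at `v`.
there-and-back : ∀ {n} (P : Polyhedron n) {v w g α} r r′ → let open Polyhedron P in
  _∈P P v → _∈P P w → InKer P g → IntegerPoint g → (∃ λ q → ℤ.∣ ↥ (g q) ∣ ≡ 1) →
  (∀ x → InKer P x → SuppSub P x g → ∃ λ s → x ≈ (s *ᵥ g)) → 0ℚ < α → w ≈ (v +ᵥ (α *ᵥ g)) →
  B r · w ≡ d r → 0ℚ < B r · g → B r′ · v ≡ d r′ → B r′ · g < 0ℚ → CircuitWalk P v v
there-and-back P {v} {w} {g} {α} r r′ v∈P w∈P Ag≡0 g-integer (q , ∣gq∣≡1) spans α>0 w≈ tight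
  g-leaves tight′ g-enters = record
  { k     = 2
  ; y     = λ { zero → v ; (suc zero) → w ; (suc (suc zero)) → v }
  ; start = λ _ → refl
  ; end   = λ _ → refl
  ; inP   = λ { zero → v∈P ; (suc zero) → w∈P ; (suc (suc zero)) → v∈P }
  ; step  = λ
    { zero → g , α , spanning-circuit P Ag≡0 g-integer (q , ∣gq∣≡1) spans , α>0 , w≈ ,
        tight-row-maximal P {v} r w≈ tight g-leaves
    ; (suc zero) → -g , α , spanning-circuit P A-g≡0 -g-integer (q , ∣-gq∣≡1) -spans , α>0 , v≈ ,
        tight-row-maximal P {w} r′ v≈ tight′ -g-leaves } }
  where
  open Polyhedron P
  -g : Vec℘ _
  -g = (- 1ℚ) *ᵥ g
  -1*-neg : ∀ t → - 1ℚ * t ≡ - t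
  -1*-neg = solve 1 (λ t → con (- 1ℚ) :* t := :- t) refl
  A-g≡0 : InKer P -g
  A-g≡0 i = trans (·-*ᵥ (A i) (- 1ℚ) g) (trans (cong (- 1ℚ *_) (Ag≡0 i)) (*-zeroʳ (- 1ℚ)))
  -g-integer : IntegerPoint -g
  -g-integer j = *-integer (- 1ℚ) (g j) refl (g-integer j)
  ∣-gq∣≡1 : ℤ.∣ ↥ (-g q) ∣ ≡ 1
  ∣-gq∣≡1 = trans (cong (λ t → ℤ.∣ ↥ t ∣) (-1*-neg (g q)))
    (trans (cong ℤ.∣_∣ (↥-neg (g q))) (trans (ℤ.∣-i∣≡∣i∣ (↥ (g q))) ∣gq∣≡1))
  -spans : ∀ x → InKer P x → SuppSub P x -g → ∃ λ s → x ≈ (s *ᵥ -g)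
  -spans x Ax≡0 x⊆-g =
    let s , x≈sg = spans x Ax≡0 (λ i Bx≢0 Bg≡0 → x⊆-g i Bx≢0
          (trans (·-*ᵥ (B i) (- 1ℚ) g) (trans (cong (- 1ℚ *_) Bg≡0) (*-zeroʳ (- 1ℚ)))))
    in - s , λ j → trans (x≈sg j)
      (solve 2 (λ s t → s :* t := (:- s) :* (con (- 1ℚ) :* t)) refl s (g j))
  v≈ : v ≈ (w +ᵥ (α *ᵥ -g))
  v≈ j = trans (solve 3 (λ a e t → a := (a :+ e :* t) :+ e :* (con (- 1ℚ) :* t)) refl (v j) α (g j))
    (cong (_+ α * (- 1ℚ * g j)) (sym (w≈ j)))
  -g-leaves : 0ℚ < B r′ · -g
  -g-leaves = subst (0ℚ <_) (sym (trans (·-*ᵥ (B r′) (- 1ℚ) g) (-1*-neg (B r′ · g))))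
    (neg-antimono-< g-enters)

p+q≡s⇒q≡s-p : ∀ p q {s} → p + q ≡ s → q ≡ s - p
p+q≡s⇒q≡s-p p q p+q≡s = trans (solve 2 (λ p q → q := (p :+ q) :+ :- p) refl p q) (cong (_- p) p+q≡s)

-- Statement (b): a transportation polytope that is a rectangle.

module TransportationExample where
  -- The margins are (3, 3) and (1, 2, 3). A point with first row (a, b, 3 - a - b) is feasible
  -- exactly when 0 ≤ a ≤ 1 and 0 ≤ b ≤ 2; the signs in the third column then follow.
  u : Fin 2 → ℕ
  u _ = 3

  v : Fin 3 → ℕ
  v j = suc (toℕ j)

  P : Polyhedron 6
  P = TransportationPolytope 2 3 u v

  grid : Grid 2 3 P
  grid = transportation-grid 2 3 u v

  open StandardForm (Grid.standard grid)

  -- In the coordinates (a, b): `v₀` is the corner (1, 0), `w` is the point (0, 1) inside the side a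
  -- = 0, `g` is the direction (-1, 1), and `d` runs along that side.
  v₀ w g d : Vec℘ 6
  v₀ = lookup (1ℚ ∷ 0ℚ ∷ ℕ→ℚ 2 ∷ 0ℚ ∷ ℕ→ℚ 2 ∷ 1ℚ ∷ [])
  w  = lookup (0ℚ ∷ 1ℚ ∷ ℕ→ℚ 2 ∷ 1ℚ ∷ 1ℚ ∷ 1ℚ ∷ [])
  g  = lookup (- 1ℚ ∷ 1ℚ ∷ 0ℚ ∷ 1ℚ ∷ - 1ℚ ∷ 0ℚ ∷ [])
  d  = lookup (0ℚ ∷ 1ℚ ∷ - 1ℚ ∷ 0ℚ ∷ - 1ℚ ∷ 1ℚ ∷ [])

  ∈P? : ∀ y → Dec ((∀ i → rowSel 2 3 i · y ≡ ℕ→ℚ (u i)) × (∀ j → colSel 2 3 j · y ≡ ℕ→ℚ (v j)) ×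
                   (∀ q → 0ℚ ≤ y q))
  ∈P? y = all? (λ i → rowSel 2 3 i · y ≟ ℕ→ℚ (u i)) ×-dec all? (λ j → colSel 2 3 j · y ≟ ℕ→ℚ (v j))
    ×-dec all? (λ q → 0ℚ ≤? y q)

  member : ∀ y → {True (∈P? y)} → _∈P P y
  member y {ok} = let rows , columns , nonneg = toWitness ok in
    Standard.feasible (Grid.standard grid) y (λ { (inj₁ i) → rows i ; (inj₂ j) → columns j }) nonneg

  row-sum : ∀ x → rowSel 2 3 zero · x ≡ x zero + x (suc zero) + x (suc (suc zero))
  row-sum x = solve 6 (λ a b c d e f → con 1ℚ :* a :+ (con 1ℚ :* b :+ (con 1ℚ :* c :+
      (con 0ℚ :* d :+ (con 0ℚ :* e :+ (con 0ℚ :* f :+ con 0ℚ))))) := (a :+ b) :+ c) refl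
    (x zero) (x (# 1)) (x (# 2)) (x (# 3)) (x (# 4)) (x (# 5))

  column-sum : ∀ x j → colSel 2 3 j · x ≡ x (Fin.combine {2} zero j) + x (Fin.combine {2} (suc zero) j)
  column-sum x zero = solve 6 (λ a b c d e f → con 1ℚ :* a :+ (con 0ℚ :* b :+ (con 0ℚ :* c :+
      (con 1ℚ :* d :+ (con 0ℚ :* e :+ (con 0ℚ :* f :+ con 0ℚ))))) := a :+ d) refl
    (x zero) (x (# 1)) (x (# 2)) (x (# 3)) (x (# 4)) (x (# 5))
  column-sum x (suc zero) = solve 6 (λ a b c d e f → con 0ℚ :* a :+ (con 1ℚ :* b :+ (con 0ℚ :* c :+
      (con 0ℚ :* d :+ (con 1ℚ :* e :+ (con 0ℚ :* f :+ con 0ℚ))))) := b :+ e) refl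
    (x zero) (x (# 1)) (x (# 2)) (x (# 3)) (x (# 4)) (x (# 5))
  column-sum x (suc (suc zero)) = solve 6 (λ a b c d e f → con 0ℚ :* a :+ (con 0ℚ :* b :+ (con 1ℚ :* c :+
      (con 0ℚ :* d :+ (con 0ℚ :* e :+ (con 1ℚ :* f :+ con 0ℚ))))) := c :+ f) refl
    (x zero) (x (# 1)) (x (# 2)) (x (# 3)) (x (# 4)) (x (# 5))

  v₀-vertex : IsVertex P v₀
  v₀-vertex = support-vertex v₀ (member v₀) unique
    where
    unique : ∀ z → _∈P P z → (∀ q → v₀ q ≡ 0ℚ → z q ≡ 0ℚ) → z ≈ v₀
    unique z (Az≡b , _) z⊆v₀ = λ
      { zero → z₀ ; (suc zero) → z₁ ; (suc (suc zero)) → z₂ ; (suc (suc (suc zero))) → z₃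
      ; (suc (suc (suc (suc zero)))) → z₄ ; (suc (suc (suc (suc (suc zero))))) → z₅ }
      where
      z₁ : z (# 1) ≡ 0ℚ
      z₁ = z⊆v₀ (# 1) refl
      z₃ : z (# 3) ≡ 0ℚ
      z₃ = z⊆v₀ (# 3) refl
      z₀ : z zero ≡ 1ℚ
      z₀ = trans (p+q≡s⇒q≡s-p (z (# 3)) (z zero)
        (trans (+-comm (z (# 3)) (z zero)) (trans (sym (column-sum z zero)) (Az≡b (inj₂ zero)))))
        (cong (λ t → 1ℚ - t) z₃)
      z₄ : z (# 4) ≡ ℕ→ℚ 2
      z₄ = trans (p+q≡s⇒q≡s-p (z (# 1)) (z (# 4))
        (trans (sym (column-sum z (# 1))) (Az≡b (inj₂ (# 1)))))
        (cong (λ t → ℕ→ℚ 2 - t) z₁)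
      z₂ : z (# 2) ≡ ℕ→ℚ 2
      z₂ = trans (p+q≡s⇒q≡s-p (z zero + z (# 1)) (z (# 2))
        (trans (sym (row-sum z)) (Az≡b (inj₁ zero))))
        (cong₂ (λ s t → ℕ→ℚ 3 - (s + t)) z₀ z₁)
      z₅ : z (# 5) ≡ 1ℚ
      z₅ = trans (p+q≡s⇒q≡s-p (z (# 2)) (z (# 5))
        (trans (sym (column-sum z (# 2))) (Az≡b (inj₂ (# 2)))))
        (cong (λ t → ℕ→ℚ 3 - t) z₂)

  g-spans : ∀ x → InKer P x → SuppSub P x g → ∃ λ s → x ≈ (s *ᵥ g)
  -- The factor is `- x zero` because `g zero` is -1. The third column vanishes with `g`, and the
  -- margin equations determine the remaining entries from `x zero`.
  g-spans x Ax≡0 x⊆g = - x zero , λ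
    { zero → solve 1 (λ a → a := (:- a) :* con (- 1ℚ)) refl (x zero)
    ; (suc zero) → trans x₁ (sym (*-identityʳ (- x zero)))
    ; (suc (suc zero)) → trans x₂ (sym (*-zeroʳ (- x zero)))
    ; (suc (suc (suc zero))) → trans
        (p+q≡s⇒q≡s-p (x zero) (x (# 3)) (trans (sym (column-sum x zero)) (Ax≡0 (inj₂ zero))))
        (solve 1 (λ a → con 0ℚ :+ :- a := (:- a) :* con 1ℚ) refl (x zero))
    ; (suc (suc (suc (suc zero)))) → trans
        (p+q≡s⇒q≡s-p (x (# 1)) (x (# 4)) (trans (sym (column-sum x (# 1))) (Ax≡0 (inj₂ (# 1)))))
        (trans (cong (λ t → 0ℚ - t) x₁)
          (solve 1 (λ a → con 0ℚ :+ :- (:- a) := (:- a) :* con (- 1ℚ)) refl (x zero)))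
    ; (suc (suc (suc (suc (suc zero))))) → trans (x-zero (# 5) refl) (sym (*-zeroʳ (- x zero))) }
    where
    x-zero : ∀ q → g q ≡ 0ℚ → x q ≡ 0ℚ
    x-zero q gq≡0 = decidable-stable (x q ≟ 0ℚ) (λ xq≢0 → SuppSub⇒support {x} {g} x⊆g q xq≢0 gq≡0)
    x₂ : x (# 2) ≡ 0ℚ
    x₂ = x-zero (# 2) refl
    x₁ : x (# 1) ≡ - x zero
    x₁ = trans (p+q≡s⇒q≡s-p (x zero + x (# 2)) (x (# 1))
        (trans (solve 3 (λ a b c → (a :+ c) :+ b := (a :+ b) :+ c) refl (x zero) (x (# 1)) (x (# 2)))
          (trans (sym (row-sum x)) (Ax≡0 (inj₁ zero)))))
      (trans (cong (λ t → 0ℚ - (x zero + t)) x₂)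
        (solve 1 (λ a → con 0ℚ :+ :- (a :+ con 0ℚ) := :- a) refl (x zero)))

  walk : CircuitWalk P v₀ v₀
  walk = there-and-back P {v₀} {w} {g} {1ℚ} zero (# 1) (member v₀) (member w)
    (λ { (inj₁ i) → from-yes (all? (λ i → rowSel 2 3 i · g ≟ 0ℚ)) i
       ; (inj₂ j) → from-yes (all? (λ j → colSel 2 3 j · g ≟ 0ℚ)) j })
    (from-yes (all? (λ q → IsInteger? (g q)))) (zero , refl) g-spans (positive⁻¹ 1ℚ)
    (from-yes (all? (λ q → w q ≟ v₀ q + 1ℚ * g q)))
    refl (from-yes (0ℚ <? ((- 1ℚ) *ᵥ unit zero) · g)) refl (from-yes (((- 1ℚ) *ᵥ unit (# 1)) · g <? 0ℚ))

  -- `w` is the midpoint of the feasible points `w + d` and `w - d`.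
  w-not-vertex : ¬ IsVertex P w
  w-not-vertex vertex = contradiction
    (vertex-rigid {P = P} {w} d vertex (member (w +ᵥ d)) (member (w +ᵥ ((- 1ℚ) *ᵥ d))) (# 1)) (λ ())

  not-VCW : ¬ VCW P
  not-VCW (_ , vertex-walks) = w-not-vertex (vertex-walks v₀ v₀ v₀-vertex v₀-vertex walk (suc zero))

-- Statement (c): a bounded-size partition polytope that is a square.

Ternary? : Decidable Ternary
Ternary? q = (q ≟ 0ℚ) ⊎-dec (q ≟ 1ℚ) ⊎-dec (q ≟ - 1ℚ)

module BoundedPartitionExample where
  P : Polyhedron 4
  P = BoundedPartitionPolytope 2 2 (λ _ → 0) (λ _ → 2)

  cell : Fin 2 → Fin 2 → Fin 4
  cell = Fin.combine

  row-sum : ∀ x i → rowSel 2 2 i · x ≡ x (cell i zero) + x (cell i (suc zero))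
  row-sum x zero = solve 4 (λ a b c d → con 1ℚ :* a :+ (con 1ℚ :* b :+
      (con 0ℚ :* c :+ (con 0ℚ :* d :+ con 0ℚ))) := a :+ b) refl (x zero) (x (# 1)) (x (# 2)) (x (# 3))
  row-sum x (suc zero) = solve 4 (λ a b c d → con 0ℚ :* a :+ (con 0ℚ :* b :+
      (con 1ℚ :* c :+ (con 1ℚ :* d :+ con 0ℚ))) := c :+ d) refl (x zero) (x (# 1)) (x (# 2)) (x (# 3))

  column-sum : ∀ x j → colSel 2 2 j · x ≡ x (cell zero j) + x (cell (suc zero) j)
  column-sum x zero = solve 4 (λ a b c d → con 1ℚ :* a :+ (con 0ℚ :* b :+
      (con 1ℚ :* c :+ (con 0ℚ :* d :+ con 0ℚ))) := a :+ c) refl (x zero) (x (# 1)) (x (# 2)) (x (# 3))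
  column-sum x (suc zero) = solve 4 (λ a b c d → con 0ℚ :* a :+ (con 1ℚ :* b :+
      (con 0ℚ :* c :+ (con 1ℚ :* d :+ con 0ℚ))) := b :+ d) refl (x zero) (x (# 1)) (x (# 2)) (x (# 3))

  negated-row : ∀ i (x : Vec℘ 4) → ((- 1ℚ) *ᵥ rowSel 2 2 i) · x ≡ - (rowSel 2 2 i · x)
  negated-row i x = trans (*ᵥ-· (- 1ℚ) (rowSel 2 2 i) x)
    (solve 1 (λ t → con (- 1ℚ) :* t := :- t) refl (rowSel 2 2 i · x))

  standard : Standard P
  standard = record
    { bound    = inj₂ ∘ inj₂
    ; B-bound  = λ _ → refl
    ; d-bound  = λ _ → refl
    -- The size bounds follow from the rest: each cluster size is a sum of two entries, and these
    -- lie between 0 and 1 by the column equations.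
    ; feasible = λ x Ax≡b x≥0 → Ax≡b , λ
      { (inj₁ i) → subst (_≤ 0ℚ) (sym (negated-row i x))
          (neg-antimono-≤ (∑-nonneg (sel-nonneg (rowOf 2 2) i x≥0)))
      ; (inj₂ (inj₁ i)) → subst (_≤ ℕ→ℚ 2) (sym (row-sum x i))
          (+-mono-≤ (entry≤1 x Ax≡b x≥0 (cell i zero)) (entry≤1 x Ax≡b x≥0 (cell i (suc zero))))
      ; (inj₂ (inj₂ q)) → nonneg⇒-unit-row x≥0 q } }
    where
    entry≤1 : ∀ (x : Vec℘ 4) → (∀ j → colSel 2 2 j · x ≡ 1ℚ) → (∀ q → 0ℚ ≤ x q) → ∀ q → x q ≤ 1ℚ
    entry≤1 x columns x≥0 q =
      subst (x q ≤_) (columns (columnOf 2 2 q)) (entry≤class-sum (columnOf 2 2) x≥0 q)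

  open StandardForm standard
  open PartitionForm standard (columnOf 2 2) (λ x x∈P → proj₁ x∈P)

  supports⇒SuppSub : ∀ {x y} → (∀ i → rowSel 2 2 i · x ≢ 0ℚ → rowSel 2 2 i · y ≢ 0ℚ) →
                     (∀ q → x q ≢ 0ℚ → y q ≢ 0ℚ) → SuppSub P x y
  supports⇒SuppSub {x} {y} rows entries = λ
    { (inj₁ i) x-row≢0 y-row≡0 → rows i
        (λ x≡0 → x-row≢0 (trans (negated-row i x) (cong (λ t → - t) x≡0)))
        (-p≡0⇒p≡0 (rowSel 2 2 i · y) (trans (sym (negated-row i y)) y-row≡0))
    ; (inj₂ (inj₁ i)) → rows i
    ; (inj₂ (inj₂ q)) → -unit-row-support x y entries q }

  ∈P? : ∀ y → Dec ((∀ j → colSel 2 2 j · y ≡ 1ℚ) × (∀ q → 0ℚ ≤ y q))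
  ∈P? y = all? (λ j → colSel 2 2 j · y ≟ 1ℚ) ×-dec all? (λ q → 0ℚ ≤? y q)

  member : ∀ y → {True (∈P? y)} → _∈P P y
  member y {ok} = Standard.feasible standard y (proj₁ (toWitness ok)) (proj₂ (toWitness ok))

  -- `swap j` moves item `j` to the first cluster, along a side of the square. `diagonal` exchanges
  -- two items between the clusters and so preserves both cluster sizes.
  swap : Fin 2 → Vec℘ 4
  swap zero       = lookup (1ℚ ∷ 0ℚ ∷ - 1ℚ ∷ 0ℚ ∷ [])
  swap (suc zero) = lookup (0ℚ ∷ 1ℚ ∷ 0ℚ ∷ - 1ℚ ∷ [])

  diagonal : Vec℘ 4
  diagonal = lookup (1ℚ ∷ - 1ℚ ∷ - 1ℚ ∷ 1ℚ ∷ [])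

  swap-kernel : ∀ j → InKer P (swap j)
  swap-kernel = from-yes (all? (λ j → all? (λ i → colSel 2 2 i · swap j ≟ 0ℚ)))

  swap-ternary : ∀ j q → Ternary (swap j q)
  swap-ternary = from-yes (all? (λ j → all? (λ q → Ternary? (swap j q))))

  swap-nonzero : ∀ j → swap j (cell zero j) ≢ 0ℚ
  swap-nonzero = from-yes (all? (λ j → ¬? (swap j (cell zero j) ≟ 0ℚ)))

  swap-support : ∀ j {y : Vec℘ 4} → y (cell zero j) ≢ 0ℚ →
    y (cell (suc zero) j) ≢ 0ℚ → ∀ q → swap j q ≢ 0ℚ → y q ≢ 0ℚ
  swap-support zero       y₀ y₂ zero                   _ = y₀
  swap-support zero       y₀ y₂ (suc zero)             s = contradiction refl s
  swap-support zero       y₀ y₂ (suc (suc zero))       _ = y₂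
  swap-support zero       y₀ y₂ (suc (suc (suc zero))) s = contradiction refl s
  swap-support (suc zero) y₁ y₃ zero                   s = contradiction refl s
  swap-support (suc zero) y₁ y₃ (suc zero)             _ = y₁
  swap-support (suc zero) y₁ y₃ (suc (suc zero))       s = contradiction refl s
  swap-support (suc zero) y₁ y₃ (suc (suc (suc zero))) _ = y₃

  -- A fractional entry makes the other entry of its column nonzero as well, so the vertex could
  -- move both ways along `swap j`.
  vertices-integer : GCW P
  vertices-integer v vertex = λ
    { zero                   → first zero
    ; (suc zero)             → first (suc zero)
    ; (suc (suc zero))       → subst IsIntegerℚ (sym (complement zero)) (complement-integer zero)
    ; (suc (suc (suc zero))) → subst IsIntegerℚ (sym (complement (suc zero))) (complement-integer (suc zero)) }
    where
    total : ∀ j → v (cell zero j) + v (cell (suc zero) j) ≡ 1ℚ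
    total j = trans (sym (column-sum v j)) (proj₁ (proj₁ vertex) j)
    complement : ∀ j → v (cell (suc zero) j) ≡ 1ℚ - v (cell zero j)
    complement j = p+q≡s⇒q≡s-p (v (cell zero j)) (v (cell (suc zero) j)) (total j)
    first : ∀ j → IsIntegerℚ (v (cell zero j))
    first j = decidable-stable (IsInteger? (v (cell zero j))) (λ v₀∉ → swap-nonzero j
      (vertex-support-rigid {v} {swap j} vertex (swap-kernel j) (swap-ternary j)
        (swap-support j {v}
          (λ v₀≡0 → v₀∉ (subst IsIntegerℚ (sym v₀≡0) refl))
          (λ v₁≡0 → v₀∉ (subst IsIntegerℚ
            (trans (sym (total j)) (trans (cong (v (cell zero j) +_) v₁≡0) (+-identityʳ (v (cell zero j)))))
            refl)))
        (cell zero j)))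
    complement-integer : ∀ j → IsIntegerℚ (1ℚ - v (cell zero j))
    complement-integer j = +-integer 1ℚ (- v (cell zero j)) refl (neg-integer (v (cell zero j)) (first j))

  opposite : ∀ x → InKer P x → ∀ j → x (cell (suc zero) j) ≡ 0ℚ - x (cell zero j)
  opposite x Ax≡0 j = p+q≡s⇒q≡s-p (x (cell zero j)) (x (cell (suc zero) j))
    (trans (sym (column-sum x j)) (Ax≡0 j))

  diagonal-multiple : ∀ x → InKer P x → x zero + x (# 1) ≡ 0ℚ → x ≈ (x zero *ᵥ diagonal)
  diagonal-multiple x Ax≡0 sum≡0 = λ
    { zero → sym (*-identityʳ (x zero))
    ; (suc zero) → trans x₁ (solve 1 (λ a → con 0ℚ :+ :- a := a :* con (- 1ℚ)) refl (x zero))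
    ; (suc (suc zero)) → trans (opposite x Ax≡0 zero)
        (solve 1 (λ a → con 0ℚ :+ :- a := a :* con (- 1ℚ)) refl (x zero))
    ; (suc (suc (suc zero))) → trans (opposite x Ax≡0 (suc zero)) (trans (cong (λ t → 0ℚ - t) x₁)
        (solve 1 (λ a → con 0ℚ :+ :- (con 0ℚ :+ :- a) := a :* con 1ℚ) refl (x zero))) }
    where
    x₁ : x (# 1) ≡ 0ℚ - x zero
    x₁ = p+q≡s⇒q≡s-p (x zero) (x (# 1)) sum≡0

  -- If the size of the first cluster changes along `g`, so does that of the second, and some
  -- `swap j` has its support within that of `g`. If it stays fixed, `g` is a nonzero multiple of
  -- `diagonal`.
  circuits-ternary : ∀ g → IsCircuit P g → ∀ q → Ternary (g q)
  circuits-ternary g circuit@(Ag≡0 , (p , gp≢0) , _) = by-cases (g zero ≟ 0ℚ) (g zero + g (# 1) ≟ 0ℚ)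
    where
    swap⇒ternary : g zero + g (# 1) ≢ 0ℚ → ∀ j → g (cell zero j) ≢ 0ℚ → ∀ q → Ternary (g q)
    swap⇒ternary sum≢0 j g₀≢0 = circuit-ternary {g} {swap j} circuit (swap-kernel j) (swap-ternary j)
      (cell zero j , swap-nonzero j)
      (supports⇒SuppSub {swap j} {g}
        (λ { zero _ row≡0 → sum≢0 (trans (sym (row-sum g zero)) row≡0)
           ; (suc zero) _ row≡0 → sum≢0 (-p≡0⇒p≡0 (g zero + g (# 1)) (trans
               (solve 2 (λ a b → :- (a :+ b) := (con 0ℚ :+ :- a) :+ (con 0ℚ :+ :- b)) refl (g zero) (g (# 1)))
               (trans (sym (cong₂ _+_ (opposite g Ag≡0 zero) (opposite g Ag≡0 (suc zero))))
                 (trans (sym (row-sum g (suc zero))) row≡0)))) })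
        (swap-support j {g} g₀≢0 (λ g₁≡0 → g₀≢0 (-p≡0⇒p≡0 (g (cell zero j))
          (trans (sym (+-identityˡ (- g (cell zero j)))) (trans (sym (opposite g Ag≡0 j)) g₁≡0))))))
    by-cases : Dec (g zero ≡ 0ℚ) → Dec (g zero + g (# 1) ≡ 0ℚ) → ∀ q → Ternary (g q)
    by-cases (no g₀≢0)  (no sum≢0) = swap⇒ternary sum≢0 zero g₀≢0
    by-cases (yes g₀≡0) (no sum≢0) = swap⇒ternary sum≢0 (suc zero)
      (λ g₁≡0 → sum≢0 (cong₂ _+_ g₀≡0 g₁≡0))
    by-cases (no g₀≢0)  (yes sum≡0) = circuit-ternary {g} {diagonal} circuit
      (from-yes (all? (λ j → colSel 2 2 j · diagonal ≟ 0ℚ))) (from-yes (all? (λ q → Ternary? (diagonal q))))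
      (zero , λ ()) (SuppSub-multiple P (g zero) {g} {diagonal} g₀≢0 (diagonal-multiple g Ag≡0 sum≡0))
    by-cases (yes g₀≡0) (yes sum≡0) = contradiction
      (trans (diagonal-multiple g Ag≡0 sum≡0 p) (trans (cong (_* diagonal p) g₀≡0) (*-zeroˡ (diagonal p)))) gp≢0

  vcw : VCW P
  vcw = vertex-walks (integral-walks vertices-integer circuits-ternary)

  v₁ v₂ : Vec℘ 4
  v₁ = lookup (0ℚ ∷ 1ℚ ∷ 1ℚ ∷ 0ℚ ∷ [])
  v₂ = lookup (1ℚ ∷ 0ℚ ∷ 0ℚ ∷ 1ℚ ∷ [])

  diagonal-spans : ∀ x → InKer P x → SuppSub P x diagonal → ∃ λ s → x ≈ (s *ᵥ diagonal)
  diagonal-spans x Ax≡0 x⊆ = x zero , diagonal-multiple x Ax≡0 (trans (sym (row-sum x zero))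
    -- A size row vanishes on `diagonal`, so it has to vanish on `x`; this rules out the two side
    -- directions and makes the diagonal a circuit.
    (decidable-stable (rowSel 2 2 zero · x ≟ 0ℚ) (λ row≢0 → x⊆ (inj₂ (inj₁ zero)) row≢0 refl)))

  v₁-vertex : IsVertex P v₁
  v₁-vertex = integer-vertex v₁ (member v₁) (from-yes (all? (λ q → IsInteger? (v₁ q))))

  walk : CircuitWalk P v₁ v₁
  walk = there-and-back P {v₁} {v₂} {diagonal} {1ℚ} (inj₂ (inj₂ (# 1))) (inj₂ (inj₂ zero))
    (member v₁) (member v₂)
    (from-yes (all? (λ j → colSel 2 2 j · diagonal ≟ 0ℚ))) (from-yes (all? (λ q → IsInteger? (diagonal q))))
    (zero , refl) diagonal-spans (positive⁻¹ 1ℚ) (from-yes (all? (λ q → v₂ q ≟ v₁ q + 1ℚ * diagonal q)))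
    refl (from-yes (0ℚ <? ((- 1ℚ) *ᵥ unit (# 1)) · diagonal))
    refl (from-yes (((- 1ℚ) *ᵥ unit zero) · diagonal <? 0ℚ))

  -- P is the square with vertices v₁, a, v₂, a′ in cyclic order, and v₁ + v₂ = a + a′, so a face
  -- containing v₁ and v₂ contains a as well.
  not-edge : ¬ IsEdge P v₁ v₂
  not-edge (_ , _ , _ , c , δ , valid , c·v₁≡δ , c·v₂≡δ , segment) =
    off-segment (segment a (member a) (≤-antisym (valid a (member a)) δ≤c·a))
    where
    a a′ : Vec℘ 4
    a  = lookup (1ℚ ∷ 1ℚ ∷ 0ℚ ∷ 0ℚ ∷ [])
    a′ = lookup (0ℚ ∷ 0ℚ ∷ 1ℚ ∷ 1ℚ ∷ [])
    c·a+c·a′ : c · a + c · a′ ≡ δ + δ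
    c·a+c·a′ = trans (sym (·-+ᵥ c a a′)) (trans
      (·-congʳ c (from-yes (all? (λ q → a q + a′ q ≟ v₁ q + v₂ q))))
      (trans (·-+ᵥ c v₁ v₂) (cong₂ _+_ c·v₁≡δ c·v₂≡δ)))
    δ≤c·a : δ ≤ c · a
    δ≤c·a = 0≤q-p⇒p≤q (subst (0ℚ ≤_)
      (trans (solve 2 (λ d y → d :+ :- y := ((d :+ d) :+ :- y) :+ :- d) refl δ (c · a′))
        (trans (cong (λ t → (t - c · a′) - δ) (sym c·a+c·a′))
          (solve 3 (λ x y d → ((x :+ y) :+ :- y) :+ :- d := x :+ :- d) refl (c · a) (c · a′) δ)))
      (p≤q⇒0≤q-p (valid a′ (member a′))))
    -- On the segment the first cluster has total size 1, whereas `a` puts both items into it.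
    off-segment : ¬ (∃ λ t → 0ℚ ≤ t × t ≤ 1ℚ × a ≈ ((t *ᵥ v₁) +ᵥ ((1ℚ - t) *ᵥ v₂)))
    off-segment (t , _ , _ , a≈) = contradiction
      (trans (cong₂ _+_ (a≈ zero) (a≈ (# 1)))
        (solve 1 (λ t → (t :* con 0ℚ :+ (con 1ℚ :+ :- t) :* con 1ℚ)
                     :+ (t :* con 1ℚ :+ (con 1ℚ :+ :- t) :* con 0ℚ) := con 1ℚ) refl t))
      (λ ())

  not-ECW : ¬ ECW P
  not-ECW (_ , edge-walks) = not-edge (proj₂ (edge-walks v₁ v₁ v₁-vertex v₁-vertex walk) zero)

-- Statement (a): two parallel elements and a coloop.

module MatroidExample where
  bit : Bool → ℕ
  bit s = if s then 1 else 0

  rank : Subset 3 → ℕ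
  rank (s ∷ t ∷ r ∷ []) = bit (s ∨ t) ℕ.+ bit r

  M : Matroid 3
  M = record
    { f          = rank
    -- The matroid axioms are checked by exhaustive search: `anySubset?` decides existence, so each
    -- axiom is obtained by refuting a counterexample.
    ; bounded    = λ S → decidable-stable (rank S ℕ.≤? ∣ S ∣) (λ bad →
        from-no (anySubset? (λ S → ¬? (rank S ℕ.≤? ∣ S ∣))) (S , bad))
    ; monotone   = λ S T S⊆T → decidable-stable (rank S ℕ.≤? rank T) (λ bad →
        from-no (anySubset? (λ S → anySubset? (λ T → (S ⊆? T) ×-dec ¬? (rank S ℕ.≤? rank T))))
          (S , T , S⊆T , bad))
    ; submodular = λ S T → decidable-stable
        (rank (S ∪ T) ℕ.+ rank (S ∩ T) ℕ.≤? rank S ℕ.+ rank T) (λ bad →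
        from-no (anySubset? (λ S → anySubset? (λ T →
            ¬? (rank (S ∪ T) ℕ.+ rank (S ∩ T) ℕ.≤? rank S ℕ.+ rank T))))
          (S , T , bad)) }

  P : Polyhedron 3
  P = MatroidPolytope M

  open Polyhedron P using (B; d)

  parallel-pair coloop : Subset 3
  parallel-pair = true ∷ true ∷ false ∷ []
  coloop        = false ∷ false ∷ true ∷ []

  -- `P` is a triangular prism: x ≥ 0, x₀ + x₁ ≤ 1, x₂ ≤ 1.
  facet : Fin 5 → Polyhedron.J P
  facet = lookup
    (inj₁ zero ∷ inj₁ (# 1) ∷ inj₁ (# 2) ∷ inj₂ parallel-pair ∷ inj₂ coloop ∷ [])

  pair-sum : ∀ x → indicator parallel-pair · x ≡ x zero + x (# 1)
  pair-sum x = solve 3 (λ a b c → con 1ℚ :* a :+ (con 1ℚ :* b :+ (con 0ℚ :* c :+ con 0ℚ)) := a :+ b) refl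
    (x zero) (x (# 1)) (x (# 2))

  coloop-sum : ∀ x → indicator coloop · x ≡ x (# 2)
  coloop-sum x = solve 3 (λ a b c → con 0ℚ :* a :+ (con 0ℚ :* b :+ (con 1ℚ :* c :+ con 0ℚ)) := c) refl
    (x zero) (x (# 1)) (x (# 2))

  module _ (x : Vec℘ 3) (facets : ∀ r → B (facet r) · x ≤ d (facet r)) where
    coordinate-nonneg : ∀ e → ((- 1ℚ) *ᵥ unit e) · x ≤ 0ℚ → 0ℚ ≤ x e
    coordinate-nonneg e row≤0 = subst (0ℚ ≤_) (solve 1 (λ a → :- (:- a) := a) refl (x e))
      (neg-antimono-≤ (subst (_≤ 0ℚ) (-unit-· e x) row≤0))

    nonneg : ∀ e → 0ℚ ≤ x e
    nonneg zero             = coordinate-nonneg zero (facets zero)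
    nonneg (suc zero)       = coordinate-nonneg (# 1) (facets (# 1))
    nonneg (suc (suc zero)) = coordinate-nonneg (# 2) (facets (# 2))

    pair≤1 : x zero + x (# 1) ≤ 1ℚ
    pair≤1 = subst (_≤ 1ℚ) (pair-sum x) (facets (# 3))

    coloop≤1 : x (# 2) ≤ 1ℚ
    coloop≤1 = subst (_≤ 1ℚ) (coloop-sum x) (facets (# 4))

    pair-part : ∀ s t → ℕ→ℚ (bit s) * x zero + ℕ→ℚ (bit t) * x (# 1) ≤ ℕ→ℚ (bit (s ∨ t))
    pair-part false false = ≤-reflexive
      (solve 2 (λ a b → con 0ℚ :* a :+ con 0ℚ :* b := con 0ℚ) refl (x zero) (x (# 1)))
    pair-part false true = subst (_≤ 1ℚ)
      (solve 2 (λ a b → b := con 0ℚ :* a :+ con 1ℚ :* b) refl (x zero) (x (# 1)))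
      (≤-trans (q≤p+q (x (# 1)) (nonneg zero)) pair≤1)
    pair-part true false = subst (_≤ 1ℚ)
      (solve 2 (λ a b → a := con 1ℚ :* a :+ con 0ℚ :* b) refl (x zero) (x (# 1)))
      (≤-trans (p≤p+q (x zero) (nonneg (# 1))) pair≤1)
    pair-part true true = subst (_≤ 1ℚ)
      (solve 2 (λ a b → a :+ b := con 1ℚ :* a :+ con 1ℚ :* b) refl (x zero) (x (# 1))) pair≤1

    coloop-part : ∀ r → ℕ→ℚ (bit r) * x (# 2) ≤ ℕ→ℚ (bit r)
    coloop-part false = ≤-reflexive (*-zeroˡ (x (# 2)))
    coloop-part true  = subst (_≤ 1ℚ) (sym (*-identityˡ (x (# 2)))) coloop≤1

    bit-+ : ∀ s t → ℕ→ℚ (bit s) + ℕ→ℚ (bit t) ≡ ℕ→ℚ (bit s ℕ.+ bit t)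
    bit-+ false false = refl
    bit-+ false true  = refl
    bit-+ true  false = refl
    bit-+ true  true  = refl

    indicator-bit : ∀ s → (if s then 1ℚ else 0ℚ) ≡ ℕ→ℚ (bit s)
    indicator-bit false = refl
    indicator-bit true  = refl

    -- The rank is additive over the parallel pair and the coloop, so each rank inequality is a sum
    -- of one inequality for either part.
    facets⇒∈P : _∈P P x
    facets⇒∈P = (λ ()) , λ
      { (inj₁ e) → nonneg⇒-unit-row nonneg e
      ; (inj₂ (s ∷ t ∷ r ∷ [])) → subst₂ _≤_
          (trans (solve 6 (λ a b c s t r → (s :* a :+ t :* b) :+ r :* c
                       := s :* a :+ (t :* b :+ (r :* c :+ con 0ℚ))) refl
                   (x zero) (x (# 1)) (x (# 2)) (ℕ→ℚ (bit s)) (ℕ→ℚ (bit t)) (ℕ→ℚ (bit r)))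
            (sym (·-congˡ {a = indicator (s ∷ t ∷ r ∷ [])}
              {lookup (ℕ→ℚ (bit s) ∷ ℕ→ℚ (bit t) ∷ ℕ→ℚ (bit r) ∷ [])} x (λ
              { zero → indicator-bit s ; (suc zero) → indicator-bit t
              ; (suc (suc zero)) → indicator-bit r }))))
          (bit-+ (s ∨ t) r)
          (+-mono-≤ (pair-part s t) (coloop-part r)) }

  member : ∀ x → {True (all? (λ r → B (facet r) · x ≤? d (facet r)))} → _∈P P x
  member x {ok} = facets⇒∈P x (toWitness ok)

  -- The edge directions of the prism.
  direction : Fin 4 → Vec℘ 3
  direction zero                   = unit zero
  direction (suc zero)             = unit (# 1)
  direction (suc (suc zero))       = unit (# 2)
  direction (suc (suc (suc zero))) = lookup (1ℚ ∷ - 1ℚ ∷ 0ℚ ∷ [])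

  direction-ternary : ∀ k r → Ternary (B (facet r) · direction k)
  direction-ternary = from-yes (all? (λ k → all? (λ r → Ternary? (B (facet r) · direction k))))

  module _ {v : Vec℘ 3} (vertex : IsVertex P v) where
    rigid : ∀ k → (∀ r → B (facet r) · direction k ≢ 0ℚ → B (facet r) · v ≢ d (facet r)) →
            ∀ q → direction k q ≡ 0ℚ
    rigid k = essential-rigid P facet (λ x _ → facets⇒∈P x) {v} {direction k} vertex (λ ()) (direction-ternary k)

    zero-coordinate : ∀ e → ((- 1ℚ) *ᵥ unit e) · v ≡ 0ℚ → v e ≡ 0ℚ
    zero-coordinate e row≡0 = -p≡0⇒p≡0 (v e) (trans (sym (-unit-· e v)) row≡0)

    zero-integer : ∀ {p} → p ≡ 0ℚ → IsIntegerℚ p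
    zero-integer refl = refl

    one-integer : ∀ {p} → p ≡ 1ℚ → IsIntegerℚ p
    one-integer refl = refl

    -- If `v e` were fractional, no facet changing along the direction could be tight, and rigidity
    -- would make the direction vanish at `e`.
    by-direction : ∀ {e} k → direction k e ≢ 0ℚ →
      (∀ r → B (facet r) · direction k ≢ 0ℚ → B (facet r) · v ≡ d (facet r) → IsIntegerℚ (v e)) →
      IsIntegerℚ (v e)
    by-direction {e} k moves tight⇒integer = decidable-stable (IsInteger? (v e)) (λ ve∉ →
      moves (rigid k (λ r Bt≢0 Bv≡d → ve∉ (tight⇒integer r Bt≢0 Bv≡d)) e))

    integer-coordinate : ∀ e → IsIntegerℚ (v e)
    integer-coordinate zero = first (v (# 1) ≟ 0ℚ)
      where
      -- If the other parallel coordinate is zero, the moving facets are x₀ ≥ 0 and x₀ + x₁ ≤ 1, and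
      -- tightness of either fixes x₀ to 0 or 1. Otherwise the direction (1, -1, 0) keeps x₀ + x₁
      -- constant, and x₁ ≥ 0 is slack.
      first : Dec (v (# 1) ≡ 0ℚ) → IsIntegerℚ (v zero)
      first (yes v₁≡0) = by-direction zero (λ ()) λ
        { zero _ tight → zero-integer (zero-coordinate zero tight)
        ; (suc zero) B≢0 _ → contradiction refl B≢0
        ; (suc (suc zero)) B≢0 _ → contradiction refl B≢0
        ; (suc (suc (suc zero))) _ tight → one-integer
            (trans (sym (+-identityʳ (v zero))) (trans (cong (v zero +_) (sym v₁≡0))
              (trans (sym (pair-sum v)) tight)))
        ; (suc (suc (suc (suc zero)))) B≢0 _ → contradiction refl B≢0 }
      first (no v₁≢0) = by-direction (# 3) (λ ()) λ
        { zero _ tight → zero-integer (zero-coordinate zero tight)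
        ; (suc zero) _ tight → contradiction (zero-coordinate (# 1) tight) v₁≢0
        ; (suc (suc zero)) B≢0 _ → contradiction refl B≢0
        ; (suc (suc (suc zero))) B≢0 _ → contradiction refl B≢0
        ; (suc (suc (suc (suc zero)))) B≢0 _ → contradiction refl B≢0 }
    integer-coordinate (suc zero) = second (v zero ≟ 0ℚ)
      where
      second : Dec (v zero ≡ 0ℚ) → IsIntegerℚ (v (# 1))
      second (yes v₀≡0) = by-direction (# 1) (λ ()) λ
        { zero B≢0 _ → contradiction refl B≢0
        ; (suc zero) _ tight → zero-integer (zero-coordinate (# 1) tight)
        ; (suc (suc zero)) B≢0 _ → contradiction refl B≢0
        ; (suc (suc (suc zero))) _ tight → one-integer
            (trans (sym (+-identityˡ (v (# 1)))) (trans (cong (_+ v (# 1)) (sym v₀≡0))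
              (trans (sym (pair-sum v)) tight)))
        ; (suc (suc (suc (suc zero)))) B≢0 _ → contradiction refl B≢0 }
      second (no v₀≢0) = by-direction (# 3) (λ ()) λ
        { zero _ tight → contradiction (zero-coordinate zero tight) v₀≢0
        ; (suc zero) _ tight → zero-integer (zero-coordinate (# 1) tight)
        ; (suc (suc zero)) B≢0 _ → contradiction refl B≢0
        ; (suc (suc (suc zero))) B≢0 _ → contradiction refl B≢0
        ; (suc (suc (suc (suc zero)))) B≢0 _ → contradiction refl B≢0 }
    integer-coordinate (suc (suc zero)) = by-direction (# 2) (λ ()) λ
      { zero B≢0 _ → contradiction refl B≢0
      ; (suc zero) B≢0 _ → contradiction refl B≢0
      ; (suc (suc zero)) _ tight → zero-integer (zero-coordinate (# 2) tight)
      ; (suc (suc (suc zero))) B≢0 _ → contradiction refl B≢0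
      ; (suc (suc (suc (suc zero)))) _ tight → one-integer (trans (sym (coloop-sum v)) tight) }

  gcw : GCW P
  gcw v vertex = integer-coordinate vertex

  v₀ w g : Vec℘ 3
  v₀ = unit (# 2)
  w  = lookup (½ ∷ ½ ∷ ½ ∷ [])
  g  = lookup (1ℚ ∷ 1ℚ ∷ - 1ℚ ∷ [])

  v₀-vertex : IsVertex P v₀
  v₀-vertex = member v₀ , c , 1ℚ , valid , refl , unique
    where
    -- Chosen so that `1ℚ - c · y` is the sum of the slacks of the three facets through `v₀`.
    c : Vec℘ 3
    c = lookup (- 1ℚ ∷ - 1ℚ ∷ 1ℚ ∷ [])
    gap : ∀ y → 1ℚ - c · y ≡ y zero + (y (# 1) + (1ℚ - y (# 2)))
    gap y = solve 3 (λ a b e → con 1ℚ :+ :- (con (- 1ℚ) :* a :+ (con (- 1ℚ) :* b :+ (con 1ℚ :* e :+ con 0ℚ)))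
        := a :+ (b :+ (con 1ℚ :+ :- e))) refl
      (y zero) (y (# 1)) (y (# 2))
    0≤y : ∀ y → _∈P P y → ∀ e → 0ℚ ≤ y e
    0≤y y (_ , By≤d) = nonneg y (By≤d ∘ facet)
    0≤1-y₂ : ∀ y → _∈P P y → 0ℚ ≤ 1ℚ - y (# 2)
    0≤1-y₂ y (_ , By≤d) = p≤q⇒0≤q-p (coloop≤1 y (By≤d ∘ facet))
    valid : Valid P c 1ℚ
    valid y y∈P = 0≤q-p⇒p≤q (subst (0ℚ ≤_) (sym (gap y))
      (+-mono-≤ (0≤y y y∈P zero) (+-mono-≤ (0≤y y y∈P (# 1)) (0≤1-y₂ y y∈P))))
    unique : ∀ y → _∈P P y → c · y ≡ 1ℚ → y ≈ v₀
    unique y y∈P c·y≡1 = λ { zero → y₀≡0 ; (suc zero) → y₁≡0 ; (suc (suc zero)) → y₂≡1 }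
      where
      sum≡0 : y zero + (y (# 1) + (1ℚ - y (# 2))) ≡ 0ℚ
      sum≡0 = trans (sym (gap y)) (cong (λ t → 1ℚ - t) c·y≡1)
      rest≥0 : 0ℚ ≤ y (# 1) + (1ℚ - y (# 2))
      rest≥0 = +-mono-≤ (0≤y y y∈P (# 1)) (0≤1-y₂ y y∈P)
      rest≤0 : y (# 1) + (1ℚ - y (# 2)) ≤ 0ℚ
      rest≤0 = subst (y (# 1) + (1ℚ - y (# 2)) ≤_) sum≡0
        (q≤p+q (y (# 1) + (1ℚ - y (# 2))) (0≤y y y∈P zero))
      y₀≡0 : y zero ≡ 0ℚ
      y₀≡0 = ≤-antisym (subst (y zero ≤_) sum≡0 (p≤p+q (y zero) rest≥0)) (0≤y y y∈P zero)
      y₁≡0 : y (# 1) ≡ 0ℚ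
      y₁≡0 = ≤-antisym (≤-trans (p≤p+q (y (# 1)) (0≤1-y₂ y y∈P)) rest≤0) (0≤y y y∈P (# 1))
      y₂≡1 : y (# 2) ≡ 1ℚ
      y₂≡1 = ≤-antisym (0≤q-p⇒p≤q (0≤1-y₂ y y∈P))
        (0≤q-p⇒p≤q (subst (0ℚ ≤_) (solve 1 (λ a → :- (con 1ℚ :+ :- a) := a :+ :- con 1ℚ) refl (y (# 2)))
          (neg-antimono-≤ (≤-trans (q≤p+q (1ℚ - y (# 2)) (0≤y y y∈P (# 1))) rest≤0))))

  -- The rank rows of the two pairs formed by the coloop and one parallel element vanish on `g`.
  -- They are not facets of the prism, yet they cut the candidates down to a line and so make `g` a
  -- circuit.
  g-spans : ∀ x → InKer P x → SuppSub P x g → ∃ λ s → x ≈ (s *ᵥ g)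
  g-spans x _ x⊆g = - x (# 2) , λ
    { zero → coordinate (x zero) (trans (solve 3 (λ a b c → a :+ c := con 1ℚ :* a :+ (con 0ℚ :* b :+
          (con 1ℚ :* c :+ con 0ℚ))) refl (x zero) (x (# 1)) (x (# 2))) (row-zero (true ∷ false ∷ true ∷ []) refl))
    ; (suc zero) → coordinate (x (# 1)) (trans (solve 3 (λ a b c → b :+ c := con 0ℚ :* a :+ (con 1ℚ :* b :+
          (con 1ℚ :* c :+ con 0ℚ))) refl (x zero) (x (# 1)) (x (# 2))) (row-zero (false ∷ true ∷ true ∷ []) refl))
    ; (suc (suc zero)) → solve 1 (λ a → a := (:- a) :* con (- 1ℚ)) refl (x (# 2)) }
    where
    row-zero : ∀ S → indicator S · g ≡ 0ℚ → indicator S · x ≡ 0ℚ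
    row-zero S S·g≡0 = decidable-stable (indicator S · x ≟ 0ℚ) (λ S·x≢0 → x⊆g (inj₂ S) S·x≢0 S·g≡0)
    coordinate : ∀ a → a + x (# 2) ≡ 0ℚ → a ≡ - x (# 2) * 1ℚ
    coordinate a a+x₂≡0 = trans
      (p+q≡s⇒q≡s-p (x (# 2)) a (trans (+-comm (x (# 2)) a) a+x₂≡0))
      (solve 1 (λ c → con 0ℚ :+ :- c := (:- c) :* con 1ℚ) refl (x (# 2)))

  walk : CircuitWalk P v₀ v₀
  -- The sum of the two parallel coordinates grows at rate 2, so it reaches its bound 1 after a step
  -- of length ½.
  walk = there-and-back P {v₀} {w} {g} {½} (inj₂ parallel-pair) (inj₁ zero) (member v₀) (member w)
    (λ ()) (from-yes (all? (λ q → IsInteger? (g q)))) (zero , refl) g-spans (positive⁻¹ ½)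
    (from-yes (all? (λ q → w q ≟ v₀ q + ½ * g q)))
    refl (from-yes (0ℚ <? indicator parallel-pair · g))
    refl (from-yes (((- 1ℚ) *ᵥ unit zero) · g <? 0ℚ))

  not-ICW : ¬ ICW P
  not-ICW (_ , integral-walks) =
    contradiction (integral-walks v₀ v₀ v₀-vertex v₀-vertex walk (suc zero) zero) (λ ())

theorem4 : (Σ ℕ λ m → Σ (Matroid m) λ M →
    GCW (MatroidPolytope M) × ¬ ICW (MatroidPolytope M))
    × (Σ ℕ λ m → Σ ℕ λ n → Σ (Fin m → ℕ) λ u → Σ (Fin n → ℕ) λ v →
    ICW (TransportationPolytope m n u v) × ¬ VCW (TransportationPolytope m n u v))
    × (Σ ℕ λ k → Σ ℕ λ n → Σ (Fin k → ℕ) λ κ⁻ → Σ (Fin k → ℕ) λ κ⁺ →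
    VCW (BoundedPartitionPolytope k n κ⁻ κ⁺) × ¬ ECW (BoundedPartitionPolytope k n κ⁻ κ⁺))
    × (∀ (k n : ℕ) (κ : Fin k → ℕ) → ECW (FixedPartitionPolytope k n κ))
theorem4 =
  (3 , MatroidExample.M , MatroidExample.gcw , MatroidExample.not-ICW) ,
  (2 , 3 , TransportationExample.u , TransportationExample.v ,
    GridForm.icw TransportationExample.grid , TransportationExample.not-VCW) ,
  (2 , 2 , (λ _ → 0) , (λ _ → 2) , BoundedPartitionExample.vcw , BoundedPartitionExample.not-ECW) ,
  fixed-partition-ECW
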